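{- For every integer $n$, \begin{align*} \frac{1}{\Theta_6(q)}=(-1)^n q^{ -\frac{3n^2+n}{2}}\bigg\{&\sum_{\substack{\alpha,\beta\in\mathbb Z\\ \alpha+2\beta=3n+1}}(-1)^\beta\sum_{k_1=|\alpha|}^\infty \binom{2k_1}{k_1+\alpha}A_{k_1}(q)\sum_{k_2=|\beta|}^\infty \binom{2k_2}{k_2+\beta}C_{k_2}(q)\\ &+\sum_{\substack{\alpha,\beta\in\mathbb Z\\ \alpha+2\beta=3n}}(-1)^\beta\sum_{k_1=|\alpha|}^\infty \binom{2k_1}{k_1+\alpha}A_{k_1}(q)\sum_{k_2=|\beta|}^\infty \binom{2k_2}{k_2+\beta}C_{k_2}(q)\bigg\}. \end{align*}
   Context: Here $(a;q)_\infty:=\prod_{j=0}^\infty(1-aq^j)$ for $|q|<1$. Identities may be read as identities of formal Laurent series in $q$ (equivalently, for $0<|q|<1$). MacMahon's $q$-series are, for integers $k\ge 0$ (with the empty-sum convention $A_0(q)=C_0(q)=1$), $$A_k(q):=\sum_{0<t_1<t_2<\cdots<t_k}\frac{q^{t_1+\cdots+t_k}}{(1-q^{t_1})^2\cdots(1-q^{t_k})^2},\qquad C_k(q):=\sum_{0<t_1<t_2<\cdots<t_k}\frac{q^{2t_1+\cdots+2t_k-k}}{(1-q^{2t_1-1})^2\cdots(1-q^{2t_k-1})^2}.$$ The theta function $\Theta_6$ is $$\Theta_6(q):=(q;q)_\infty^3(q;q^2)_\infty^2=\frac12\sum_{n\in\mathbb Z}\chi_6(n)\,n\,q^{\frac{n^2-1}{24}},$$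 where $\chi_6(n)=1$ if $n\equiv1\pmod 6$, $\chi_6(n)=-1$ if $n\equiv-1\pmod 6$, and $\chi_6(n)=0$ otherwise. -}

module Defs where

open import Data.Empty using (⊥-elim)
open import Data.Integer.Base as ℤ using (ℤ; +_; -[1+_]; 0ℤ; 1ℤ; -1ℤ; ∣_∣)
open import Data.Integer.DivMod using (_/ℕ_)
import Data.Integer.Properties as ℤₚ
open import Data.List.Base using (List; []; _∷_; foldr; upTo; applyUpTo; map; filter; _++_;
  cartesianProduct; cartesianProductWith)
open import Data.List.Membership.Propositional using (_∈_; _∉_)
open import Data.List.Membership.Propositional.Properties using (∈-applyUpTo⁻; ∈-upTo⁺; ∈-upTo⁻;
  ∈-filter⁺; ∈-cartesianProductWith⁺; ∈-cartesianProduct⁺; ∈-++⁺ˡ; ∈-++⁺ʳ; ∈-map⁺; ∈-map⁻)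
open import Data.List.Relation.Unary.All as All using (All; []; _∷_)
open import Data.List.Relation.Unary.All.Properties using (all-filter)
open import Data.List.Relation.Unary.Any using (here; there)
open import Data.List.Relation.Unary.AllPairs using ([]; _∷_)
open import Data.List.Relation.Unary.Unique.Propositional using (Unique)
import Data.List.Relation.Unary.Unique.Propositional.Properties as Uniq
open import Data.Nat.Base as ℕ using (ℕ; zero; suc; _∸_; _≤_; _<_; z≤n; s≤s)
open import Data.Nat.Combinatorics using (_C_)
import Data.Nat.Properties as ℕₚ
open import Data.Product using (Σ; _×_; _,_; proj₁; proj₂)
open import Data.Vec.Base as Vec using (Vec; []; _∷_)
open import Data.Vec.Properties using (∷-injective)
open import Data.Vec.Relation.Unary.Linked using (Linked; []; [-]; _∷_; linked?)
open import Relation.Binary.PropositionalEquality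
  using (_≡_; refl; sym; trans; cong; cong₂; module ≡-Reasoning)
open import Relation.Nullary using (yes; no)
open import Relation.Unary using (Decidable)

Series : Set
Series = ℕ → ℤ

sumOver : {I : Set} → List I → (I → ℤ) → ℤ
sumOver L f = foldr (λ i s → f i ℤ.+ s) 0ℤ L

const : ℤ → Series
const c zero    = c
const c (suc _) = 0ℤ

1ˢ : Series
1ˢ = const 1ℤ

infix 10 q^_
q^_ : ℕ → Series
(q^ zero)  N       = 1ˢ N
(q^ suc m) zero    = 0ℤ
(q^ suc m) (suc N) = (q^ m) N

infixl 6 _+ˢ_ _-ˢ_
infixl 7 _*ˢ_
infixr 8 _^ˢ_

_+ˢ_ _-ˢ_ _*ˢ_ : Series → Series → Series
(f +ˢ g) N = f N ℤ.+ g N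
(f -ˢ g) N = f N ℤ.- g N
(f *ˢ g) N = sumOver (upTo (suc N)) (λ i → f i ℤ.* g (N ∸ i))

_^ˢ_ : Series → ℕ → Series
f ^ˢ zero  = 1ˢ
f ^ˢ suc k = f *ˢ f ^ˢ k

∏ˢ : ∀ {k} → Vec Series k → Series
∏ˢ = Vec.foldr _ _*ˢ_ 1ˢ

-- The multiplicative inverse of a series with constant coefficient 1
-- (see recip-inverse; the value is meaningless for other series).  It
-- is determined by  g 0 = 1  and  g (n + 1) = - ∑_{i ≤ n} f (i + 1) g (n - i);
-- recipCoeffs f n  lists  g n , … , g 0.

dot : ∀ {n} → (ℕ → ℤ) → Vec ℤ n → ℤ
dot h []       = 0ℤ
dot h (x ∷ xs) = h 0 ℤ.* x ℤ.+ dot (λ i → h (suc i)) xs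

recipCoeffs : Series → (n : ℕ) → Vec ℤ (suc n)
recipCoeffs f zero    = 1ℤ ∷ []
recipCoeffs f (suc n) = ℤ.- dot (λ i → f (suc i)) (recipCoeffs f n) ∷ recipCoeffs f n

recip : Series → Series
recip f n = Vec.head (recipCoeffs f n)

dot-recip : ∀ f n (h k : ℕ → ℤ) (e : ℕ → ℕ) →
  (∀ i → k (e i) ≡ h i ℤ.* recip f (n ∸ i)) →
  dot h (recipCoeffs f n) ≡ sumOver (applyUpTo e (suc n)) k
dot-recip f zero    h k e eq = cong (ℤ._+ 0ℤ) (sym (eq 0))
dot-recip f (suc n) h k e eq =
  cong₂ ℤ._+_ (sym (eq 0))
    (dot-recip f n (λ i → h (suc i)) k (λ i → e (suc i)) (λ i → eq (suc i)))

recip-inverse : ∀ f → f 0 ≡ 1ℤ → ∀ N → (f *ˢ recip f) N ≡ 1ˢ N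
recip-inverse f f₀ zero    rewrite f₀ = refl
recip-inverse f f₀ (suc n) = begin
  f 0 ℤ.* (ℤ.- d) ℤ.+ s  ≡⟨ cong₂ (λ x y → x ℤ.* (ℤ.- d) ℤ.+ y) f₀
                              (sym (dot-recip f n (λ i → f (suc i))
                                (λ i → f i ℤ.* recip f (suc n ∸ i)) suc (λ _ → refl))) ⟩
  1ℤ ℤ.* (ℤ.- d) ℤ.+ d   ≡⟨ cong (ℤ._+ d) (ℤₚ.*-identityˡ (ℤ.- d)) ⟩
  ℤ.- d ℤ.+ d            ≡⟨ ℤₚ.+-inverseˡ d ⟩
  0ℤ                     ∎
  where
  open ≡-Reasoning
  d s : ℤ
  d = dot (λ i → f (suc i)) (recipCoeffs f n)
  s = sumOver (applyUpTo suc (suc n)) (λ i → f i ℤ.* recip f (suc n ∸ i))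

OrderAtLeast : ℕ → Series → Set
OrderAtLeast m f = ∀ {N} → N < m → f N ≡ 0ℤ

sumOver-zero : ∀ {I : Set} (L : List I) {f : I → ℤ} →
  (∀ {i} → i ∈ L → f i ≡ 0ℤ) → sumOver L f ≡ 0ℤ
sumOver-zero []      z = refl
sumOver-zero (i ∷ L) z = cong₂ ℤ._+_ (z (here refl)) (sumOver-zero L (λ p → z (there p)))

0*-zero : ∀ {x} y → x ≡ 0ℤ → x ℤ.* y ≡ 0ℤ
0*-zero y refl = ℤₚ.*-zeroˡ y

*0-zero : ∀ x {y} → y ≡ 0ℤ → x ℤ.* y ≡ 0ℤ
*0-zero x refl = ℤₚ.*-zeroʳ x

*ˢ-orderˡ : ∀ {m} f g → OrderAtLeast m f → OrderAtLeast m (f *ˢ g)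
*ˢ-orderˡ f g of {N} N<m = sumOver-zero (upTo (suc N)) λ {i} i∈ →
  0*-zero (g (N ∸ i)) (of (ℕₚ.≤-<-trans (ℕₚ.≤-pred (∈-upTo⁻ i∈)) N<m))

*ˢ-orderʳ : ∀ {m} f g → OrderAtLeast m g → OrderAtLeast m (f *ˢ g)
*ˢ-orderʳ f g og {N} N<m = sumOver-zero (upTo (suc N)) λ {i} i∈ →
  *0-zero (f i) (og (ℕₚ.≤-<-trans (ℕₚ.m∸n≤m N i) N<m))

q^-order : ∀ m → OrderAtLeast m (q^ m)
q^-order (suc m) {zero}  _         = refl
q^-order (suc m) {suc N} (s≤s N<m) = q^-order m N<m

^ˢ-order : ∀ b → b 0 ≡ 0ℤ → ∀ j → OrderAtLeast j (b ^ˢ j)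
^ˢ-order b b₀ (suc j) {N} N<1+j = sumOver-zero (upTo (suc N)) (go _)
  where
  go : ∀ i → i ∈ upTo (suc N) → b i ℤ.* (b ^ˢ j) (N ∸ i) ≡ 0ℤ
  go zero    _  = 0*-zero ((b ^ˢ j) N) b₀
  go (suc i) i∈ = *0-zero (b (suc i)) (^ˢ-order b b₀ j
    (ℕₚ.<-≤-trans (ℕₚ.∸-monoʳ-< {N} (s≤s z≤n) (ℕₚ.≤-pred (∈-upTo⁻ i∈))) (ℕₚ.≤-pred N<1+j)))

Stabilises : (ℕ → Series) → Set
Stabilises s = ∀ N → Σ ℕ λ K → ∀ k → K ≤ k → s k N ≡ s K N

lim : (s : ℕ → Series) → Stabilises s → Series
lim s st N = s (proj₁ (st N)) N

partialProduct : (ℕ → Series) → ℕ → Series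
partialProduct u zero    = 1ˢ
partialProduct u (suc k) = u k *ˢ partialProduct u k

1-h*p : ∀ h p N → OrderAtLeast (suc N) h → ((1ˢ -ˢ h) *ˢ p) N ≡ p N
1-h*p h p N oh = begin
  (1ℤ ℤ.- h 0) ℤ.* p N ℤ.+ s  ≡⟨ cong₂ (λ x y → (1ℤ ℤ.- x) ℤ.* p N ℤ.+ y) (oh (s≤s z≤n)) s≡0 ⟩
  1ℤ ℤ.* p N ℤ.+ 0ℤ           ≡⟨ ℤₚ.+-identityʳ _ ⟩
  1ℤ ℤ.* p N                  ≡⟨ ℤₚ.*-identityˡ (p N) ⟩
  p N                         ∎
  where
  open ≡-Reasoning
  s : ℤ
  s = sumOver (applyUpTo suc N) (λ i → (1ˢ -ˢ h) i ℤ.* p (N ∸ i))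

  s≡0 : s ≡ 0ℤ
  s≡0 = sumOver-zero (applyUpTo suc N) go
    where
    go : ∀ {i} → i ∈ applyUpTo suc N → (1ˢ -ˢ h) i ℤ.* p (N ∸ i) ≡ 0ℤ
    go i∈ with ∈-applyUpTo⁻ suc i∈
    ... | j , j<N , refl =
      0*-zero (p (N ∸ suc j)) (cong (λ x → 0ℤ ℤ.- x) (oh (s≤s j<N)))

pochhammerFactor : (a b : Series) → ℕ → Series
pochhammerFactor a b j = 1ˢ -ˢ a *ˢ b ^ˢ j

pochhammer-stabilises : ∀ a b → b 0 ≡ 0ℤ → Stabilises (partialProduct (pochhammerFactor a b))
pochhammer-stabilises a b b₀ N = suc N , λ k K≤k → go (ℕₚ.≤⇒≤′ K≤k)
  where
  go : ∀ {k} → suc N ℕ.≤′ k →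
    partialProduct (pochhammerFactor a b) k N ≡ partialProduct (pochhammerFactor a b) (suc N) N
  go ℕ.≤′-refl         = refl
  go (ℕ.≤′-step {k} p) = trans
    (1-h*p (a *ˢ b ^ˢ k) (partialProduct (pochhammerFactor a b) k) N
      λ M<1+N → *ˢ-orderʳ a (b ^ˢ k) (^ˢ-order b b₀ k) (ℕₚ.<-≤-trans M<1+N (ℕₚ.≤′⇒≤ p)))
    (go p)

-- (a ; b)_∞ = ∏_{j ≥ 0} (1 - a b^j); the product converges because the
-- base b has zero constant coefficient.

pochhammer∞ : (a b : Series) → b 0 ≡ 0ℤ → Series
pochhammer∞ a b b₀ = lim (partialProduct (pochhammerFactor a b)) (pochhammer-stabilises a b b₀)

Θ₆ : Series
Θ₆ = pochhammer∞ (q^ 1) (q^ 1) refl ^ˢ 3 *ˢ pochhammer∞ (q^ 1) (q^ 2) refl ^ˢ 2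

Θ₆-constant : Θ₆ 0 ≡ 1ℤ
Θ₆-constant = refl

-- Infinite sums  ∑_{i : I, P i} f i  of locally finite families: for each
-- N only finitely many indices satisfying P contribute to the coefficient
-- of q^N.  The value of the sum does not depend on the chosen supports.

record LocallyFinite {I : Set} (P : I → Set) (f : I → Series) : Set where
  field
    support  : ℕ → List I
    unique   : ∀ N → Unique (support N)
    inside   : ∀ N → All P (support N)
    complete : ∀ N {i} → P i → i ∉ support N → f i N ≡ 0ℤ

open LocallyFinite public

∑ : {I : Set} (P : I → Set) (f : I → Series) → LocallyFinite P f → Series
∑ P f lf N = sumOver (support lf N) (λ i → f i N)

fromCandidates : {I : Set} {P : I → Set} {f : I → Series} → Decidable P →
  (cands : ℕ → List I) → (∀ N → Unique (cands N)) →
  (∀ N {i} → P i → i ∉ cands N → f i N ≡ 0ℤ) → LocallyFinite P f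
fromCandidates P? cands u c = record
  { support  = λ N → filter P? (cands N)
  ; unique   = λ N → Uniq.filter⁺ P? (u N)
  ; inside   = λ N → all-filter P? (cands N)
  ; complete = λ N p i∉ → c N p (λ i∈ → i∉ (∈-filter⁺ P? i∈ p))
  }

∑-order : {I : Set} {P : I → Set} {f : I → Series} (lf : LocallyFinite P f) → ∀ {m} →
  (∀ {i} → P i → OrderAtLeast m (f i)) → OrderAtLeast m (∑ P f lf)
∑-order lf o {N} N<m = sumOver-zero (support lf N) λ i∈ → o (All.lookup (inside lf N) i∈) N<m

outside : ∀ {f w N} → OrderAtLeast w f → (w ≤ N → f N ≡ 0ℤ) → f N ≡ 0ℤ
outside {w = w} {N} o h with w ℕₚ.≤? N
... | yes w≤N = h w≤N
... | no  w≰N = o (ℕₚ.≰⇒> w≰N)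

-- 0 < t₁ < ⋯ < tₖ
Increasing : ∀ {k} → Vec ℕ k → Set
Increasing t = Linked _<_ (0 ∷ t)

-- For increasing t the entries are positive, so every denominator has
-- constant coefficient 1 and the truncated subtractions are exact.

denominatorA denominatorC : ∀ {k} → Vec ℕ k → Series
denominatorA t = ∏ˢ (Vec.map (λ tᵢ → (1ˢ -ˢ q^ tᵢ) ^ˢ 2) t)
denominatorC t = ∏ˢ (Vec.map (λ tᵢ → (1ˢ -ˢ q^ (2 ℕ.* tᵢ ∸ 1)) ^ˢ 2) t)

termA termC : ∀ {k} → Vec ℕ k → Series
termA     t = q^ Vec.sum t *ˢ recip (denominatorA t)
termC {k} t = q^ (2 ℕ.* Vec.sum t ∸ k) *ˢ recip (denominatorC t)

k≤sum : ∀ {k m} {t : Vec ℕ k} → Linked _<_ (m ∷ t) → k ≤ Vec.sum t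
k≤sum [-]                        = z≤n
k≤sum {t = _ ∷ _} (m<t₁ ∷ inc) = ℕₚ.+-mono-≤ (ℕₚ.≤-trans (s≤s z≤n) m<t₁) (k≤sum inc)

termA-order : ∀ {k} (t : Vec ℕ k) → OrderAtLeast (Vec.sum t) (termA t)
termA-order t = *ˢ-orderˡ (q^ Vec.sum t) (recip (denominatorA t)) (q^-order (Vec.sum t))

termC-order : ∀ {k} {t : Vec ℕ k} → Increasing t → OrderAtLeast (Vec.sum t) (termC t)
termC-order {k} {t} inc N<s =
  *ˢ-orderˡ (q^ (2 ℕ.* s ∸ k)) (recip (denominatorC t)) (q^-order (2 ℕ.* s ∸ k)) (ℕₚ.<-≤-trans N<s s≤2s-k)
  where
  open ℕₚ.≤-Reasoning
  s = Vec.sum t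
  s≤2s-k : s ≤ 2 ℕ.* s ∸ k
  s≤2s-k = begin
    s               ≡⟨ sym (ℕₚ.+-identityʳ s) ⟩
    s ℕ.+ 0         ≡⟨ sym (ℕₚ.m+n∸m≡n s (s ℕ.+ 0)) ⟩
    2 ℕ.* s ∸ s     ≤⟨ ℕₚ.∸-monoʳ-≤ (2 ℕ.* s) (k≤sum inc) ⟩
    2 ℕ.* s ∸ k     ∎

vecs : ℕ → (k : ℕ) → List (Vec ℕ k)
vecs N zero    = [] ∷ []
vecs N (suc k) = cartesianProductWith _∷_ (upTo (suc N)) (vecs N k)

vecs-unique : ∀ N k → Unique (vecs N k)
vecs-unique N zero    = [] ∷ []
vecs-unique N (suc k) =
  Uniq.cartesianProductWith⁺ _∷_ ∷-injective (Uniq.upTo⁺ (suc N)) (vecs-unique N k)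

∈-vecs : ∀ {N k} (t : Vec ℕ k) → Vec.sum t ≤ N → t ∈ vecs N k
∈-vecs []       _   = here refl
∈-vecs (x ∷ xs) s≤N = ∈-cartesianProductWith⁺ _∷_
  (∈-upTo⁺ (s≤s (ℕₚ.≤-trans (ℕₚ.m≤m+n x (Vec.sum xs)) s≤N)))
  (∈-vecs xs (ℕₚ.≤-trans (ℕₚ.m≤n+m (Vec.sum xs) x) s≤N))

increasing? : ∀ {k} → Decidable (Increasing {k})
increasing? t = linked? ℕₚ._<?_ (0 ∷ t)

tuples-locallyFinite : ∀ {k} (f : Vec ℕ k → Series) →
  (∀ {t} → Increasing t → OrderAtLeast (Vec.sum t) (f t)) → LocallyFinite Increasing f
tuples-locallyFinite {k} f o = fromCandidates increasing? (λ N → vecs N k)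
  (λ N → vecs-unique N k)
  (λ N {t} inc t∉ → outside {f t} (o inc) λ s≤N → ⊥-elim (t∉ (∈-vecs t s≤N)))

termA-locallyFinite : ∀ k → LocallyFinite Increasing (termA {k})
termA-locallyFinite k = tuples-locallyFinite termA (λ {t} _ → termA-order t)

termC-locallyFinite : ∀ k → LocallyFinite Increasing (termC {k})
termC-locallyFinite k = tuples-locallyFinite termC termC-order

-- MacMahon's A_k(q) and C_k(q)
𝒜 𝒞 : ℕ → Series
𝒜 k = ∑ Increasing (termA {k}) (termA-locallyFinite k)
𝒞 k = ∑ Increasing (termC {k}) (termC-locallyFinite k)

𝒜-order : ∀ k → OrderAtLeast k (𝒜 k)
𝒜-order k = ∑-order (termA-locallyFinite k)
  λ {t} inc N<k → termA-order t (ℕₚ.<-≤-trans N<k (k≤sum inc))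

𝒞-order : ∀ k → OrderAtLeast k (𝒞 k)
𝒞-order k = ∑-order (termC-locallyFinite k)
  λ inc N<k → termC-order inc (ℕₚ.<-≤-trans N<k (k≤sum inc))

-- For |α| ≤ k the integer k + α is nonnegative, so ∣_∣ merely casts it to ℕ.
binomial : ℕ → ℤ → ℤ
binomial k α = + ((2 ℕ.* k) C ∣ + k ℤ.+ α ∣)

binomialTerm : (ℕ → Series) → ℤ → ℕ → Series
binomialTerm F α k = const (binomial k α) *ˢ F k

binomialTerm-locallyFinite : ∀ F → (∀ k → OrderAtLeast k (F k)) → ∀ α →
  LocallyFinite (∣ α ∣ ≤_) (binomialTerm F α)
binomialTerm-locallyFinite F o α = fromCandidates (∣ α ∣ ℕₚ.≤?_)
  (λ N → upTo (suc N)) (λ N → Uniq.upTo⁺ (suc N))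
  (λ N {k} _ k∉ → outside {binomialTerm F α k} (*ˢ-orderʳ (const (binomial k α)) (F k) (o k))
    λ k≤N → ⊥-elim (k∉ (∈-upTo⁺ (s≤s k≤N))))

binomialSum : (F : ℕ → Series) → (∀ k → OrderAtLeast k (F k)) → ℤ → Series
binomialSum F o α = ∑ (∣ α ∣ ≤_) (binomialTerm F α) (binomialTerm-locallyFinite F o α)

binomialSum-order : ∀ F o α → OrderAtLeast ∣ α ∣ (binomialSum F o α)
binomialSum-order F o α = ∑-order (binomialTerm-locallyFinite F o α)
  λ {k} α≤k N<α → *ˢ-orderʳ (const (binomial k α)) (F k) (o k) (ℕₚ.<-≤-trans N<α α≤k)

-1^_ : ℤ → ℤ
-1^ n = -1ℤ ℤ.^ ∣ n ∣

OnLine : ℤ → ℤ × ℤ → Set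
OnLine m (α , β) = α ℤ.+ + 2 ℤ.* β ≡ m

pairTerm : ℤ × ℤ → Series
pairTerm (α , β) = const (-1^ β) *ˢ (binomialSum 𝒜 𝒜-order α *ˢ binomialSum 𝒞 𝒞-order β)

interval : ℕ → List ℤ
interval N = map +_ (upTo (suc N)) ++ map -[1+_] (upTo N)

interval-unique : ∀ N → Unique (interval N)
interval-unique N = Uniq.++⁺ (Uniq.map⁺ ℤₚ.+-injective (Uniq.upTo⁺ (suc N)))
  (Uniq.map⁺ ℤₚ.-[1+-injective (Uniq.upTo⁺ N)) disjoint
  where
  disjoint : ∀ {x} → x ∈ map +_ (upTo (suc N)) × x ∈ map -[1+_] (upTo N) → _
  disjoint (p , n) with ∈-map⁻ +_ p | ∈-map⁻ -[1+_] n
  ... | _ , _ , refl | _ , _ , ()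

∈-interval : ∀ {N} x → ∣ x ∣ ≤ N → x ∈ interval N
∈-interval     (+ n)    n≤N = ∈-++⁺ˡ (∈-map⁺ +_ (∈-upTo⁺ (s≤s n≤N)))
∈-interval {N} -[1+ n ] n<N = ∈-++⁺ʳ (map +_ (upTo (suc N))) (∈-map⁺ -[1+_] (∈-upTo⁺ n<N))

pairTerm-locallyFinite : ∀ m → LocallyFinite (OnLine m) pairTerm
pairTerm-locallyFinite m = fromCandidates (λ (α , β) → α ℤ.+ + 2 ℤ.* β ℤₚ.≟ m)
  (λ N → cartesianProduct (interval N) (interval N))
  (λ N → Uniq.cartesianProduct⁺ (interval-unique N) (interval-unique N))
  (λ N {(α , β)} _ αβ∉ →
    let SA = binomialSum 𝒜 𝒜-order α
        SC = binomialSum 𝒞 𝒞-order β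
        c  = const (-1^ β)
    in
    outside (*ˢ-orderʳ c (SA *ˢ SC) (*ˢ-orderˡ SA SC (binomialSum-order 𝒜 𝒜-order α))) λ α≤N →
    outside (*ˢ-orderʳ c (SA *ˢ SC) (*ˢ-orderʳ SA SC (binomialSum-order 𝒞 𝒞-order β))) λ β≤N →
    ⊥-elim (αβ∉ (∈-cartesianProduct⁺ (∈-interval α α≤N) (∈-interval β β≤N))))

lineSum : ℤ → Series
lineSum m = ∑ (OnLine m) pairTerm (pairTerm-locallyFinite m)

-- shift ∙ body  represents  q^shift · body; representations are not
-- unique, and equality is equality of all coefficients.
infix 5 _∙_
record Laurent : Set where
  constructor _∙_
  field
    shift : ℤ
    body  : Series

coeff : Laurent → ℤ → ℤ
coeff (m ∙ f) j with j ℤ.- m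
... | + N      = f N
... | -[1+ _ ] = 0ℤ

infix 4 _≈ᴸ_
_≈ᴸ_ : Laurent → Laurent → Set
f ≈ᴸ g = ∀ j → coeff f j ≡ coeff g j

infixl 7 _*ᴸ_
_*ᴸ_ : Laurent → Laurent → Laurent
(m ∙ f) *ᴸ (n ∙ g) = m ℤ.+ n ∙ f *ˢ g

ι : Series → Laurent
ι f = 0ℤ ∙ f

infix 10 qᴸ^_
qᴸ^_ : ℤ → Laurent
qᴸ^ m = m ∙ 1ˢ

-- (3n² + n) / 2; the numerator is even, so the floor division is exact.
pentagonal : ℤ → ℤ
pentagonal n = (+ 3 ℤ.* (n ℤ.* n) ℤ.+ n) /ℕ 2

{-# OPTIONS --safe #-}

-- Jacobi's triple product, in finite form, evaluates the binomial sums of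
-- MacMahon's series: since ∑_k A_k X^k = ∏ (1 + X q^t / (1 - q^t)²), putting
-- X = z + 2 + z⁻¹ gives
--
--   ∑_α z^α ∑_k C(2k, k+α) A_k = ∏ (1 + z q^t)(1 + z⁻¹ q^t) / (1 - q^t)²,
--
-- and similarly for C_k with odd exponents 2t - 1.  Hence, writing S_A(α) and
-- S_C(β) for these sums,
--
--   S_A(α) + S_A(α+1) = q^(α(α+1)/2) / (q;q)³,   S_C(β) = q^(β²) / ((q²;q²)(q;q²)²).
--
-- The two line sums pair up as S_A(α) + S_A(α+1) with α = 3n - 2β.  Completing
-- the square with β = γ + n leaves (-1)^n q^((3n²+n)/2) times Euler's pentagonal
-- series ∑ (-1)^γ q^(3γ²-γ) = (q²;q²), which cancels the factor 1/(q²;q²).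
--
-- Identities between infinite series are proved modulo every power of q, where
-- the infinite products and sums may be truncated.

module Submission where

open import Algebra.Bundles using (CommutativeRing; RawRing)
import Algebra.Solver.Ring
open import Algebra.Solver.Ring.AlmostCommutativeRing
  using (AlmostCommutativeRing; fromCommutativeRing; _-Raw-AlmostCommutative⟶_)
open import Algebra.Structures using (IsCommutativeRing)
open import Data.Empty using (⊥-elim)
open import Data.Integer.Base as ℤ
  using (ℤ; +_; -[1+_]; -_; _+_; _*_; _-_; 0ℤ; 1ℤ; -1ℤ; ∣_∣)
open import Data.Integer.DivMod using (_/ℕ_)
import Data.Integer.Properties as ℤₚ
import Data.Integer.Tactic.RingSolver as ℤ-Solver
open import Data.List.Base using (List; []; _∷_; upTo; map; filter; _++_)
open import Data.List.Membership.Propositional using (_∈_; _∉_)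
open import Data.List.Membership.Propositional.Properties
  using (∈-upTo⁺; ∈-++⁺ˡ; ∈-++⁺ʳ; ∈-map⁺; ∈-map⁻; ∈-filter⁺)
open import Data.List.Properties using (map-upTo; upTo-∷ʳ)
open import Data.List.Relation.Unary.All as All using (All; []; _∷_)
import Data.List.Relation.Unary.All.Properties as Allₚ
open import Data.List.Relation.Unary.AllPairs using ([]; _∷_)
open import Data.List.Relation.Unary.Any using (here; there)
open import Data.List.Relation.Unary.Unique.Propositional using (Unique)
import Data.List.Relation.Unary.Unique.Propositional.Properties as Uniq
import Data.Maybe.Base as Maybe
open import Data.Nat.Base as ℕ using (ℕ; zero; suc; _∸_; _≤_; _<_; z≤n; s≤s)
open import Data.Nat.Combinatorics using (_C_; nCk+nC[k+1]≡[n+1]C[k+1]; k>n⇒nCk≡0)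
open import Data.Nat.DivMod using (m*n/n≡m)
import Data.Nat.Properties as ℕₚ
import Data.Nat.Tactic.RingSolver as ℕ-Solver
open import Data.Product using (Σ; _×_; _,_; proj₂)
import Data.Product.Properties as Productₚ
open import Data.Unit.Base using (tt)
open import Data.Vec.Base as Vec using (Vec; []; _∷_)
open import Data.Vec.Properties using (∷-injectiveʳ; ≡-dec)
open import Data.Vec.Relation.Unary.Linked using (Linked; [-]; _∷_)
open import Level using (0ℓ)
open import Relation.Binary.Bundles using (Setoid)
open import Relation.Binary.Definitions using (DecidableEquality)
open import Relation.Binary.PropositionalEquality
  using (_≡_; refl; sym; trans; cong; cong₂; subst; module ≡-Reasoning)
import Relation.Binary.Reasoning.Setoid as SetoidReasoning
open import Relation.Nullary using (¬_; yes; no)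
open import Relation.Nullary.Decidable using (dec⇒maybe)
open import Relation.Unary using (Decidable)
open import Defs
open import Algebra.Properties.AbelianGroup ℤₚ.+-0-abelianGroup using (∙-cancelʳ)

-- The commutative ring of series

-- The variable z never appears: a Laurent polynomial in z is given by its coefficients, a function
-- ℤ → Series, and multiplication by 1 + z x or 1 + z⁻¹ y is a recurrence between neighbouring
-- coefficients. The MacMahon products, freed of their denominators, and the q-binomial expression
-- `tripleCoeff` obey the same recurrence and start from the same empty product, so induction
-- identifies them. One family of triple products, with separate offsets u, v and separate lengths
-- for z and z⁻¹, serves three times: (u , v) = (1 , 1) for C, (1 , 0) for A, and (2 , 4) at z = -1
-- for the pentagonal series in q². The case A shapes the theorem: ∏ (1 + z q^t)(1 + z⁻¹ q^t) over t
-- ≥ 1 lacks the factor 1 + z⁻¹ of a triple product, so the closed form is available for sums of two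
-- neighbouring coefficients, which is why the statement adds two lines.

infix 4 _≈_
record _≈_ (f g : Series) : Set where
  constructor pointwise
  field at : ∀ N → f N ≡ g N
open _≈_

+-congˡ : ∀ a {b c} → b ≡ c → a + b ≡ a + c
+-congˡ a = cong (λ x → a + x)

sumOver-cong : {I : Set} (L : List I) {f g : I → ℤ} → (∀ i → f i ≡ g i) → sumOver L f ≡ sumOver L g
sumOver-cong []      e = refl
sumOver-cong (i ∷ L) e = cong₂ _+_ (e i) (sumOver-cong L e)

sumOver-map : {I J : Set} (h : J → I) (L : List J) (f : I → ℤ) →
  sumOver (map h L) f ≡ sumOver L (λ j → f (h j))
sumOver-map h []      f = refl
sumOver-map h (j ∷ L) f = +-congˡ (f (h j)) (sumOver-map h L f)

sumOver-+ : {I : Set} (L : List I) (f g : I → ℤ) →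
  sumOver L (λ i → f i + g i) ≡ sumOver L f + sumOver L g
sumOver-+ []      f g = refl
sumOver-+ (i ∷ L) f g =
  trans (+-congˡ (f i + g i) (sumOver-+ L f g)) (swap (f i) (g i) (sumOver L f) (sumOver L g))
  where
  swap : ∀ a b c d → a + b + (c + d) ≡ a + c + (b + d)
  swap = ℤ-Solver.solve-∀

sumOver-* : {I : Set} (L : List I) (c : ℤ) (f : I → ℤ) →
  sumOver L (λ i → c * f i) ≡ c * sumOver L f
sumOver-* []      c f = sym (ℤₚ.*-zeroʳ c)
sumOver-* (i ∷ L) c f =
  trans (+-congˡ (c * f i) (sumOver-* L c f)) (sym (ℤₚ.*-distribˡ-+ c (f i) (sumOver L f)))

tail : Series → Series
tail f N = f (suc N)

-- Peeling off the constant coefficient of the left factor turns convolution into a recursion on the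
-- degree; congruence, associativity and commutativity are inductions along it.
*ˢ-suc : ∀ f g N → (f *ˢ g) (suc N) ≡ f 0 * g (suc N) + (tail f *ˢ g) N
*ˢ-suc f g N = +-congˡ (f 0 * g (suc N))
  (trans (cong (λ L → sumOver L (λ i → f i * g (suc N ∸ i))) (sym (map-upTo suc (suc N))))
         (sumOver-map suc (upTo (suc N)) (λ i → f i * g (suc N ∸ i))))

-- The bound n is what later makes truncation modulo q^n compatible with products; plain congruence
-- is recovered by taking n = N + 1 at each degree N.
*ˢ-congᵈ : ∀ {n f f′ g g′} → (∀ N → N < n → f N ≡ f′ N) → (∀ N → N < n → g N ≡ g′ N) →
  ∀ N → N < n → (f *ˢ g) N ≡ (f′ *ˢ g′) N
*ˢ-congᵈ p q zero l = cong₂ (λ x y → x * y + 0ℤ) (p 0 l) (q 0 l)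
*ˢ-congᵈ {suc n} {f} {f′} {g} {g′} p q (suc N) (s≤s l) = begin
  (f *ˢ g) (suc N)                        ≡⟨ *ˢ-suc f g N ⟩
  f 0 * g (suc N) + (tail f *ˢ g) N
      ≡⟨ cong₂ _+_ (cong₂ _*_ (p 0 (s≤s z≤n)) (q (suc N) (s≤s l)))
     (*ˢ-congᵈ {n} {tail f} {tail f′} {g} {g′} (λ M m → p (suc M) (s≤s m))
         (λ M m → q M (ℕₚ.m<n⇒m<1+n m)) N l) ⟩
  f′ 0 * g′ (suc N) + (tail f′ *ˢ g′) N   ≡⟨ *ˢ-suc f′ g′ N ⟨
  (f′ *ˢ g′) (suc N) ∎
  where open ≡-Reasoning

*ˢ-cong : ∀ {f f′ g g′} → f ≈ f′ → g ≈ g′ → f *ˢ g ≈ f′ *ˢ g′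
*ˢ-cong {f} {f′} {g} {g′} p q .at N =
  *ˢ-congᵈ {suc N} {f} {f′} {g} {g′} (λ M _ → p .at M) (λ M _ → q .at M) N ℕₚ.≤-refl

+ˢ-cong : ∀ {f f′ g g′} → f ≈ f′ → g ≈ g′ → f +ˢ g ≈ f′ +ˢ g′
+ˢ-cong p q .at N = cong₂ _+_ (p .at N) (q .at N)

0ˢ : Series
0ˢ _ = 0ℤ

-ˢ_ : Series → Series
(-ˢ f) N = - f N

*ˢ-identityˡ : ∀ f → 1ˢ *ˢ f ≈ f
-- Writing 1 as 1 - 0 makes `1-h*p` applicable with h = 0.
*ˢ-identityˡ f .at N = trans
  (*ˢ-congᵈ {suc N} {1ˢ} {1ˢ -ˢ 0ˢ} {f} {f} (λ M _ → sym (ℤₚ.+-identityʳ (1ˢ M)))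
      (λ _ _ → refl) N ℕₚ.≤-refl)
  (1-h*p 0ˢ f N (λ _ → refl))

*ˢ-distribʳ : ∀ h f g → (f +ˢ g) *ˢ h ≈ f *ˢ h +ˢ g *ˢ h
*ˢ-distribʳ h f g .at N = trans
  (sumOver-cong (upTo (suc N)) λ i → ℤₚ.*-distribʳ-+ (h (N ∸ i)) (f i) (g i))
  (sumOver-+ (upTo (suc N)) (λ i → f i * h (N ∸ i)) (λ i → g i * h (N ∸ i)))

scale : ℤ → Series → Series
scale c f N = c * f N

scale-*ˢ : ∀ c f g → scale c f *ˢ g ≈ scale c (f *ˢ g)
scale-*ˢ c f g .at N = trans
  (sumOver-cong (upTo (suc N)) λ i → ℤₚ.*-assoc c (f i) (g (N ∸ i)))
  (sumOver-* (upTo (suc N)) c (λ i → f i * g (N ∸ i)))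

*ˢ-assoc : ∀ f g h → (f *ˢ g) *ˢ h ≈ f *ˢ (g *ˢ h)
*ˢ-assoc f g h .at N = go f N
  where
  open ≡-Reasoning
  zero-case : ∀ a b c → (a * b + 0ℤ) * c + 0ℤ ≡ a * (b * c + 0ℤ) + 0ℤ
  zero-case = ℤ-Solver.solve-∀
  suc-case : ∀ a b c d e → (a * b + 0ℤ) * c + (a * d + e) ≡ a * (b * c + d) + e
  suc-case = ℤ-Solver.solve-∀
  go : ∀ f N → ((f *ˢ g) *ˢ h) N ≡ (f *ˢ (g *ˢ h)) N
  go f zero    = zero-case (f 0) (g 0) (h 0)
  go f (suc N) = begin
    ((f *ˢ g) *ˢ h) (suc N)
      ≡⟨ *ˢ-suc (f *ˢ g) h N ⟩
    (f *ˢ g) 0 * h (suc N) + (tail (f *ˢ g) *ˢ h) N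
      ≡⟨ +-congˡ ((f *ˢ g) 0 * h (suc N))
          (*ˢ-cong {g = h} (pointwise (*ˢ-suc f g)) (pointwise λ _ → refl) .at N) ⟩
    (f *ˢ g) 0 * h (suc N) + ((scale (f 0) (tail g) +ˢ tail f *ˢ g) *ˢ h) N
      ≡⟨ +-congˡ ((f *ˢ g) 0 * h (suc N))
          (*ˢ-distribʳ h (scale (f 0) (tail g)) (tail f *ˢ g) .at N) ⟩
    (f *ˢ g) 0 * h (suc N) + ((scale (f 0) (tail g) *ˢ h) N + ((tail f *ˢ g) *ˢ h) N)
      ≡⟨ +-congˡ ((f *ˢ g) 0 * h (suc N))
          (cong₂ _+_ (scale-*ˢ (f 0) (tail g) h .at N) (go (tail f) N)) ⟩
    (f *ˢ g) 0 * h (suc N) + (f 0 * (tail g *ˢ h) N + (tail f *ˢ (g *ˢ h)) N)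
      ≡⟨ suc-case (f 0) (g 0) (h (suc N)) _ _ ⟩
    f 0 * (g 0 * h (suc N) + (tail g *ˢ h) N) + (tail f *ˢ (g *ˢ h)) N
      ≡⟨ cong (λ x → f 0 * x + (tail f *ˢ (g *ˢ h)) N) (*ˢ-suc g h N) ⟨
    f 0 * (g *ˢ h) (suc N) + (tail f *ˢ (g *ˢ h)) N
      ≡⟨ *ˢ-suc f (g *ˢ h) N ⟨
    (f *ˢ (g *ˢ h)) (suc N) ∎

-- The constant coefficients of both factors are peeled off in turn, leaving a product of two tails
-- two degrees lower, where the induction hypothesis swaps them. Hence the two base cases, degrees 0
-- and 1.
*ˢ-comm : ∀ f g → f *ˢ g ≈ g *ˢ f
*ˢ-comm f g .at N = go N f g
  where
  open ≡-Reasoning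
  go : ∀ N f g → (f *ˢ g) N ≡ (g *ˢ f) N
  go zero f g = cong (_+ 0ℤ) (ℤₚ.*-comm (f 0) (g 0))
  go (suc zero) f g = one (f 0) (f 1) (g 0) (g 1)
    where
    one : ∀ a b c d → a * d + (b * c + 0ℤ) ≡ c * b + (d * a + 0ℤ)
    one = ℤ-Solver.solve-∀
  go (suc (suc N)) f g = begin
    (f *ˢ g) (suc (suc N))                                         ≡⟨ *ˢ-suc f g (suc N) ⟩
    f 0 * g₂ + (tail f *ˢ g) (suc N)
        ≡⟨ +-congˡ (f 0 * g₂) (go (suc N) (tail f) g) ⟩
    f 0 * g₂ + (g *ˢ tail f) (suc N)
        ≡⟨ +-congˡ (f 0 * g₂) (*ˢ-suc g (tail f) N) ⟩
    f 0 * g₂ + (g 0 * f₂ + (tail g *ˢ tail f) N)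
        ≡⟨ cong (λ x → f 0 * g₂ + (g 0 * f₂ + x)) (go N (tail g) (tail f)) ⟩
    f 0 * g₂ + (g 0 * f₂ + (tail f *ˢ tail g) N)                   ≡⟨ swap (f 0 * g₂) (g 0 * f₂) _ ⟩
    g 0 * f₂ + (f 0 * g₂ + (tail f *ˢ tail g) N)
        ≡⟨ +-congˡ (g 0 * f₂) (*ˢ-suc f (tail g) N) ⟨
    g 0 * f₂ + (f *ˢ tail g) (suc N)
        ≡⟨ +-congˡ (g 0 * f₂) (go (suc N) (tail g) f) ⟨
    g 0 * f₂ + (tail g *ˢ f) (suc N)                               ≡⟨ *ˢ-suc g f (suc N) ⟨
    (g *ˢ f) (suc (suc N))                                         ∎
    where
    f₂ g₂ : ℤ
    f₂ = f (suc (suc N))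
    g₂ = g (suc (suc N))
    swap : ∀ a b c → a + (b + c) ≡ b + (a + c)
    swap = ℤ-Solver.solve-∀

const-+ : ∀ a b → const (a + b) ≈ const a +ˢ const b
const-+ a b .at zero    = refl
const-+ a b .at (suc N) = refl

const-neg : ∀ a → const (- a) ≈ -ˢ const a
const-neg a .at zero    = refl
const-neg a .at (suc N) = refl

const-zero : const 0ℤ ≈ 0ˢ
const-zero .at zero    = refl
const-zero .at (suc N) = refl

const-*ˢ : ∀ a f → const a *ˢ f ≈ scale a f
const-*ˢ a f .at zero    = ℤₚ.+-identityʳ (a * f 0)
const-*ˢ a f .at (suc N) = trans (*ˢ-suc (const a) f N)
  (trans (+-congˡ (a * f (suc N)) (sumOver-zero (upTo (suc N)) λ {i} _ → refl)) (ℤₚ.+-identityʳ _))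

scale-const : ∀ a b → scale a (const b) ≈ const (a * b)
scale-const a b .at zero    = refl
scale-const a b .at (suc N) = ℤₚ.*-zeroʳ a

≈-refl : ∀ {f} → f ≈ f
≈-refl .at N = refl

≈-sym : ∀ {f g} → f ≈ g → g ≈ f
≈-sym p .at N = sym (p .at N)

≈-trans : ∀ {f g h} → f ≈ g → g ≈ h → f ≈ h
≈-trans p q .at N = trans (p .at N) (q .at N)

infixl 6 _⊕_ _⊖_
infixl 7 _⊗_
infix 8 ⊝_

-- Opaque copies of the operations on series: the originals unfold when applied
-- to a coefficient index, which defeats unification.
opaque
  _⊕_ _⊖_ _⊗_ : Series → Series → Series
  _⊕_ = _+ˢ_
  _⊖_ = _-ˢ_
  _⊗_ = _*ˢ_

  ⊝_ : Series → Series
  ⊝_ = -ˢ_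

  ⊕-def : _⊕_ ≡ _+ˢ_
  ⊕-def = refl

  ⊖-def : _⊖_ ≡ _-ˢ_
  ⊖-def = refl

  ⊗-def : _⊗_ ≡ _*ˢ_
  ⊗-def = refl

  ⊕-at : ∀ f g N → (f ⊕ g) N ≡ f N + g N
  ⊕-at f g N = refl

  ⊖-at : ∀ f g N → (f ⊖ g) N ≡ f N + - g N
  ⊖-at f g N = refl

  ⊖≈⊕⊝ : ∀ f g → f ⊖ g ≈ f ⊕ ⊝ g
  ⊖≈⊕⊝ f g .at N = refl

  ⊗-congᵈ : ∀ {n f f′ g g′} → (∀ N → N < n → f N ≡ f′ N) → (∀ N → N < n → g N ≡ g′ N) →
    ∀ N → N < n → (f ⊗ g) N ≡ (f′ ⊗ g′) N
  ⊗-congᵈ = *ˢ-congᵈ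

  ⊕⊗-isCommutativeRing : IsCommutativeRing _≈_ _⊕_ _⊗_ ⊝_ (const 0ℤ) 1ˢ
  ⊕⊗-isCommutativeRing = record
    { isRing = record
      { +-isAbelianGroup = record
        { isGroup = record
          { isMonoid = record
            { isSemigroup = record
              { isMagma = record
                { isEquivalence = record { refl = ≈-refl ; sym = ≈-sym ; trans = ≈-trans }
                ; ∙-cong = +ˢ-cong }
              ; assoc = λ f g h → pointwise λ N → ℤₚ.+-assoc (f N) (g N) (h N) }
            ; identity =
                (λ f → ≈-trans (+ˢ-cong const-zero ≈-refl) (pointwise λ N → ℤₚ.+-identityˡ (f N)))
              , (λ f → ≈-trans (+ˢ-cong {f} ≈-refl const-zero)
                  (pointwise λ N → ℤₚ.+-identityʳ (f N))) }
          ; inverse =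
              (λ f → ≈-trans (pointwise λ N → ℤₚ.+-inverseˡ (f N)) (≈-sym const-zero))
            , (λ f → ≈-trans (pointwise λ N → ℤₚ.+-inverseʳ (f N)) (≈-sym const-zero))
          ; ⁻¹-cong = λ p → pointwise λ N → cong -_ (p .at N) }
        ; comm = λ f g → pointwise λ N → ℤₚ.+-comm (f N) (g N) }
      ; *-cong     = *ˢ-cong
      ; *-assoc    = *ˢ-assoc
      ; *-identity = *ˢ-identityˡ , (λ f → ≈-trans (*ˢ-comm f 1ˢ) (*ˢ-identityˡ f))
      ; distrib    = (λ h f g → ≈-trans (*ˢ-comm h (f +ˢ g)) (≈-trans (*ˢ-distribʳ h f g)
                         (+ˢ-cong (*ˢ-comm f h) (*ˢ-comm g h))))
                   , *ˢ-distribʳ }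
    ; *-comm = *ˢ-comm }

  const-⊕ : ∀ a b → const (a + b) ≈ const a ⊕ const b
  const-⊕ = const-+

  const-⊗ : ∀ a b → const (a * b) ≈ const a ⊗ const b
  const-⊗ a b = ≈-sym (≈-trans (const-*ˢ a (const b)) (scale-const a b))

  const-⊝ : ∀ a → const (- a) ≈ ⊝ const a
  const-⊝ = const-neg

  const-⊗-at : ∀ a f N → (const a ⊗ f) N ≡ a * f N
  const-⊗-at a f N = const-*ˢ a f .at N

seriesRing : CommutativeRing 0ℓ 0ℓ
seriesRing = record { isCommutativeRing = ⊕⊗-isCommutativeRing }

open CommutativeRing seriesRing using (setoid)
  renaming (+-cong to ⊕-cong; *-cong to ⊗-cong; *-comm to ⊗-comm; *-assoc to ⊗-assoc;
            *-identityˡ to ⊗-identityˡ; *-identityʳ to ⊗-identityʳ;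
            zeroˡ to ⊗-zeroˡ; zeroʳ to ⊗-zeroʳ;
            +-comm to ⊕-comm; +-assoc to ⊕-assoc;
            +-identityˡ to ⊕-identityˡ; +-identityʳ to ⊕-identityʳ)

seriesACR : AlmostCommutativeRing 0ℓ 0ℓ
seriesACR = fromCommutativeRing seriesRing

ℤ-rawRing : RawRing 0ℓ 0ℓ
ℤ-rawRing = CommutativeRing.rawRing ℤₚ.+-*-commutativeRing

const-homomorphism : ℤ-rawRing -Raw-AlmostCommutative⟶ seriesACR
const-homomorphism = record
  { ⟦_⟧ = const ; +-homo = const-⊕ ; *-homo = const-⊗ ; -‿homo = const-⊝
  ; 0-homo = ≈-refl ; 1-homo = ≈-refl }

-- The coefficients of the solver are integers, embedded by `const`: normalisation has to compare
-- coefficients, which is decidable in ℤ but not for series.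
module Solver = Algebra.Solver.Ring ℤ-rawRing seriesACR const-homomorphism
  (λ a b → Maybe.map (λ p → CommutativeRing.reflexive seriesRing (cong const p))
      (dec⇒maybe (a ℤₚ.≟ b)))

-- Congruences modulo powers of q

≡⇒≈ : ∀ {f g} → f ≡ g → f ≈ g
≡⇒≈ refl = ≈-refl

infix 4 _≈[_]_
record _≈[_]_ (f : Series) (n : ℕ) (g : Series) : Set where
  constructor below
  field at< : ∀ N → N < n → f N ≡ g N
open _≈[_]_

≈⇒≈[] : ∀ {n f g} → f ≈ g → f ≈[ n ] g
≈⇒≈[] p .at< N _ = p .at N

≈[]⇒≈ : ∀ {f g} → (∀ n → f ≈[ n ] g) → f ≈ g
≈[]⇒≈ p .at N = p (suc N) .at< N ℕₚ.≤-refl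

≈[]-refl : ∀ {n f} → f ≈[ n ] f
≈[]-refl .at< N _ = refl

≈[]-sym : ∀ {n f g} → f ≈[ n ] g → g ≈[ n ] f
≈[]-sym p .at< N N<n = sym (p .at< N N<n)

≈[]-trans : ∀ {n f g h} → f ≈[ n ] g → g ≈[ n ] h → f ≈[ n ] h
≈[]-trans p q .at< N N<n = trans (p .at< N N<n) (q .at< N N<n)

≈[]-weaken : ∀ {m n f g} → m ≤ n → f ≈[ n ] g → f ≈[ m ] g
≈[]-weaken m≤n p .at< N N<m = p .at< N (ℕₚ.<-≤-trans N<m m≤n)

⊕-cong[] : ∀ {n f f′ g g′} → f ≈[ n ] f′ → g ≈[ n ] g′ → f ⊕ g ≈[ n ] f′ ⊕ g′
⊕-cong[] {f = f} {f′} {g} {g′} p q .at< N N<n =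
  trans (⊕-at f g N) (trans (cong₂ _+_ (p .at< N N<n) (q .at< N N<n)) (sym (⊕-at f′ g′ N)))

⊗-cong[] : ∀ {n f f′ g g′} → f ≈[ n ] f′ → g ≈[ n ] g′ → f ⊗ g ≈[ n ] f′ ⊗ g′
⊗-cong[] p q .at< = ⊗-congᵈ (p .at<) (q .at<)

⊖-cong : ∀ {f f′ g g′} → f ≈ f′ → g ≈ g′ → f ⊖ g ≈ f′ ⊖ g′
⊖-cong {f} {f′} {g} {g′} p q .at N =
  trans (⊖-at f g N) (trans (cong₂ (λ x y → x + - y) (p .at N) (q .at N)) (sym (⊖-at f′ g′ N)))

setoid[_] : ℕ → Setoid 0ℓ 0ℓ
setoid[ n ] = record
  { Carrier = Series ; _≈_ = _≈[ n ]_
  ; isEquivalence = record { refl = ≈[]-refl ; sym = ≈[]-sym ; trans = ≈[]-trans } }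

orderAtLeast⇒≈[]0 : ∀ {n f} → OrderAtLeast n f → f ≈[ n ] const 0ℤ
orderAtLeast⇒≈[]0 o .at< N N<n = trans (o N<n) (sym (const-zero .at N))

⊗≈*ˢ : ∀ f g → f ⊗ g ≈ f *ˢ g
⊗≈*ˢ f g = ≡⇒≈ (cong (λ op → op f g) ⊗-def)

q^suc-⊗ : ∀ m f N → ((q^ suc m) ⊗ f) (suc N) ≡ ((q^ m) ⊗ f) N
q^suc-⊗ m f N = begin
  ((q^ suc m) ⊗ f) (suc N)       ≡⟨ ⊗≈*ˢ (q^ suc m) f .at (suc N) ⟩
  ((q^ suc m) *ˢ f) (suc N)      ≡⟨ *ˢ-suc (q^ suc m) f N ⟩
  0ℤ + ((q^ m) *ˢ f) N           ≡⟨ ℤₚ.+-identityˡ _ ⟩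
  ((q^ m) *ˢ f) N                ≡⟨ ⊗≈*ˢ (q^ m) f .at N ⟨
  ((q^ m) ⊗ f) N                 ∎
  where open ≡-Reasoning

q^zero : q^ 0 ≈ 1ˢ
q^zero .at N = refl

q^-⊗-shift : ∀ m f N → ((q^ m) ⊗ f) (m ℕ.+ N) ≡ f N
q^-⊗-shift zero    f N = ≈-trans (⊗-cong q^zero ≈-refl) (⊗-identityˡ f) .at N
q^-⊗-shift (suc m) f N = trans (q^suc-⊗ m f (m ℕ.+ N)) (q^-⊗-shift m f N)

q^-⊗-order : ∀ m f → OrderAtLeast m ((q^ m) ⊗ f)
q^-⊗-order m f {N} N<m = trans (⊗≈*ˢ (q^ m) f .at N) (*ˢ-orderˡ (q^ m) f (q^-order m) N<m)

q^-+ : ∀ m n → q^ (m ℕ.+ n) ≈ (q^ m) ⊗ (q^ n)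
q^-+ m n .at N = go m N
  where
  go : ∀ m N → (q^ (m ℕ.+ n)) N ≡ ((q^ m) ⊗ (q^ n)) N
  go zero    N       = sym (≈-trans (⊗-cong q^zero ≈-refl) (⊗-identityˡ (q^ n)) .at N)
  go (suc m) zero    = sym (q^-⊗-order (suc m) (q^ n) (s≤s z≤n))
  go (suc m) (suc N) = trans (go m N) (sym (q^suc-⊗ m (q^ n) N))

q^≈[]0 : ∀ {n m} → n ≤ m → q^ m ≈[ n ] const 0ℤ
q^≈[]0 {m = m} n≤m = ≈[]-weaken n≤m (orderAtLeast⇒≈[]0 {f = q^ m} (q^-order m))

-- As in any commutative ring, g = f′ g′ g = f g g′ = g′. Later facts about `recip` rest on its
-- being an inverse, not on its recursion.
⊗-inverse-unique[] : ∀ {n f f′ g g′} → f ≈[ n ] f′ → f ⊗ g ≈[ n ] 1ˢ → f′ ⊗ g′ ≈[ n ] 1ˢ →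
  g ≈[ n ] g′
⊗-inverse-unique[] {n} {f} {f′} {g} {g′} f≈f′ fg f′g′ = begin
  g                ≈⟨ ≈⇒≈[] (⊗-identityˡ g) ⟨
  1ˢ ⊗ g           ≈⟨ ⊗-cong[] f′g′ ≈[]-refl ⟨
  f′ ⊗ g′ ⊗ g      ≈⟨ ⊗-cong[] (⊗-cong[] f≈f′ ≈[]-refl) ≈[]-refl ⟨
  f ⊗ g′ ⊗ g       ≈⟨ ≈⇒≈[] (solve 3 (λ f g g′ → f :* g′ :* g := f :* g :* g′) ≈-refl f g g′) ⟩
  f ⊗ g ⊗ g′       ≈⟨ ⊗-cong[] fg ≈[]-refl ⟩
  1ˢ ⊗ g′          ≈⟨ ≈⇒≈[] (⊗-identityˡ g′) ⟩
  g′               ∎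
  where
  open SetoidReasoning setoid[ n ]
  open Solver

⊗-inverse-unique : ∀ {f g g′} → f ⊗ g ≈ 1ˢ → f ⊗ g′ ≈ 1ˢ → g ≈ g′
⊗-inverse-unique p q = ≈[]⇒≈ λ n → ⊗-inverse-unique[] {n} ≈[]-refl (≈⇒≈[] p) (≈⇒≈[] q)

⊗-recip : ∀ f → f 0 ≡ 1ℤ → f ⊗ recip f ≈ 1ˢ
⊗-recip f f₀ = ≈-trans (⊗≈*ˢ f (recip f)) (pointwise (recip-inverse f f₀))

recip-⊗ : ∀ f → f 0 ≡ 1ℤ → recip f ⊗ f ≈ 1ˢ
recip-⊗ f f₀ = ≈-trans (⊗-comm (recip f) f) (⊗-recip f f₀)

recip-cong[] : ∀ {n f g} → f 0 ≡ 1ℤ → g 0 ≡ 1ℤ → f ≈[ n ] g → recip f ≈[ n ] recip g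
recip-cong[] {f = f} {g} f₀ g₀ p =
    ⊗-inverse-unique[] p (≈⇒≈[] (⊗-recip f f₀)) (≈⇒≈[] (⊗-recip g g₀))

⊗-at0 : ∀ f g → (f ⊗ g) 0 ≡ f 0 * g 0
⊗-at0 f g = trans (⊗≈*ˢ f g .at 0) (ℤₚ.+-identityʳ (f 0 * g 0))

⊗-one-at0 : ∀ {f g} → f 0 ≡ 1ℤ → g 0 ≡ 1ℤ → (f ⊗ g) 0 ≡ 1ℤ
⊗-one-at0 {f} {g} f₀ g₀ = trans (⊗-at0 f g) (cong₂ _*_ f₀ g₀)

-- Finite and infinite q-Pochhammer symbols

1-q^-at0 : ∀ m → 0 < m → (1ˢ ⊖ q^ m) 0 ≡ 1ℤ
1-q^-at0 (suc m) _ = ⊖-at 1ˢ (q^ suc m) 0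

-- poch u s n = (q^u ; q^s)_n
poch : (u s n : ℕ) → Series
poch u s zero    = 1ˢ
poch u s (suc n) = (1ˢ ⊖ q^ (u ℕ.+ s ℕ.* n)) ⊗ poch u s n

poch-at0 : ∀ u s n → 0 < u → poch u s n 0 ≡ 1ℤ
poch-at0 u s zero    0<u = refl
poch-at0 u s (suc n) 0<u =
  ⊗-one-at0 {1ˢ ⊖ q^ (u ℕ.+ s ℕ.* n)} {poch u s n}
    (1-q^-at0 (u ℕ.+ s ℕ.* n) (ℕₚ.≤-trans 0<u (ℕₚ.m≤m+n u (s ℕ.* n)))) (poch-at0 u s n 0<u)

q^-^ˢ : ∀ s n → (q^ s) ^ˢ n ≈ q^ (s ℕ.* n)
q^-^ˢ s zero    rewrite ℕₚ.*-zeroʳ s = ≈-sym q^zero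
q^-^ˢ s (suc n) = begin
  (q^ s) *ˢ (q^ s) ^ˢ n     ≈⟨ ⊗≈*ˢ (q^ s) ((q^ s) ^ˢ n) ⟨
  (q^ s) ⊗ (q^ s) ^ˢ n      ≈⟨ ⊗-cong ≈-refl (q^-^ˢ s n) ⟩
  (q^ s) ⊗ (q^ (s ℕ.* n))   ≈⟨ q^-+ s (s ℕ.* n) ⟨
  q^ (s ℕ.+ s ℕ.* n)        ≈⟨ ≡⇒≈ (cong q^_ (sym (ℕₚ.*-suc s n))) ⟩
  q^ (s ℕ.* suc n)          ∎
  where open SetoidReasoning setoid

poch≈partialProduct : ∀ u s n → poch u s n ≈ partialProduct (pochhammerFactor (q^ u) (q^ s)) n
poch≈partialProduct u s zero    = ≈-refl
poch≈partialProduct u s (suc n) = begin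
  (1ˢ ⊖ q^ (u ℕ.+ s ℕ.* n)) ⊗ poch u s n
      ≈⟨ ⊗-cong (⊖-cong ≈-refl factor) (poch≈partialProduct u s n) ⟩
  (1ˢ ⊖ (q^ u) *ˢ (q^ s) ^ˢ n) ⊗ Π n
      ≈⟨ ⊗-cong (≡⇒≈ (cong (λ op → op 1ˢ ((q^ u) *ˢ (q^ s) ^ˢ n)) ⊖-def)) ≈-refl ⟩
  pochhammerFactor (q^ u) (q^ s) n ⊗ Π n         ≈⟨ ⊗≈*ˢ _ (Π n) ⟩
  Π (suc n)                                      ∎
  where
  open SetoidReasoning setoid
  Π : ℕ → Series
  Π = partialProduct (pochhammerFactor (q^ u) (q^ s))
  factor : q^ (u ℕ.+ s ℕ.* n) ≈ (q^ u) *ˢ (q^ s) ^ˢ n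
  factor = ≈-trans (q^-+ u (s ℕ.* n))
      (≈-trans (⊗-cong ≈-refl (≈-sym (q^-^ˢ s n))) (⊗≈*ˢ (q^ u) ((q^ s) ^ˢ n)))

-- The base is q^(s + 1), not q^s.
poch∞ : (u s : ℕ) → Series
poch∞ u s = pochhammer∞ (q^ u) (q^ suc s) refl

poch≈[]poch∞ : ∀ u s {m n} → n ≤ m → poch u (suc s) m ≈[ n ] poch∞ u s
poch≈[]poch∞ u s {m} n≤m .at< N N<n = trans
  (poch≈partialProduct u (suc s) m .at N)
  -- The coefficient of q^N is stable from N + 1 factors on, and N < n ≤ m.
  (proj₂ (pochhammer-stabilises (q^ u) (q^ suc s) refl N) m (ℕₚ.<-≤-trans N<n n≤m))

poch∞-at0 : ∀ u s → 0 < u → poch∞ u s 0 ≡ 1ℤ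
poch∞-at0 u s 0<u =
    trans (sym (poch≈[]poch∞ u s {1} {1} ℕₚ.≤-refl .at< 0 (s≤s z≤n))) (poch-at0 u (suc s) 1 0<u)

-- The finite Jacobi triple product

-- This is w k + s k (k - 1) / 2, kept as a recursive sum so that no division enters the exponents.
progression : (s w k : ℕ) → ℕ
progression s w zero    = 0
progression s w (suc k) = progression s w k ℕ.+ (w ℕ.+ s ℕ.* k)

-- The exponent of q in the coefficient of z^j of the Jacobi triple product
-- ∏ (1 + z q^(u + (u+v) t)) (1 + z⁻¹ q^(v + (u+v) t)).
exponent : (u v : ℕ) → ℤ → ℕ
exponent u v (+ k)    = progression (u ℕ.+ v) u k
exponent u v -[1+ k ] = progression (u ℕ.+ v) v (suc k)

exponent-neg : ∀ u v j → exponent u v (- j) ≡ exponent v u j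
exponent-neg u v (+ zero)  = refl
exponent-neg u v (+ suc k) = cong (λ s → progression s v (suc k)) (ℕₚ.+-comm u v)
exponent-neg u v -[1+ k ]  = cong (λ s → progression s u (suc k)) (ℕₚ.+-comm u v)

2*progression : ∀ s w k → + 2 * + progression s w k ≡ + s * (+ k * + k) + (+ 2 * + w - + s) * + k
2*progression s w zero    = base (+ s) (+ w)
  where
  base : ∀ s w → + 2 * 0ℤ ≡ s * (0ℤ * 0ℤ) + (+ 2 * w - s) * 0ℤ
  base = ℤ-Solver.solve-∀
2*progression s w (suc k) = begin
  + 2 * (+ p + (+ w + + (s ℕ.* k)))
      ≡⟨ cong (λ x → + 2 * (+ p + (+ w + x))) (ℤₚ.pos-* s k) ⟩
  + 2 * (+ p + (+ w + + s * + k))                ≡⟨ expand (+ p) (+ w) (+ s) (+ k) ⟩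
  + 2 * + p + + 2 * (+ w + + s * + k)
      ≡⟨ cong (λ x → x + + 2 * (+ w + + s * + k)) (2*progression s w k) ⟩
  + s * (+ k * + k) + (+ 2 * + w - + s) * + k + + 2 * (+ w + + s * + k) ≡⟨ step (+ s) (+ w) (+ k) ⟩
  + s * (+ suc k * + suc k) + (+ 2 * + w - + s) * + suc k ∎
  where
  open ≡-Reasoning
  p : ℕ
  p = progression s w k
  expand : ∀ p w s k → + 2 * (p + (w + s * k)) ≡ + 2 * p + + 2 * (w + s * k)
  expand = ℤ-Solver.solve-∀
  step : ∀ s w k → s * (k * k) + (+ 2 * w - s) * k + + 2 * (w + s * k) ≡
    s * ((1ℤ + k) * (1ℤ + k)) + (+ 2 * w - s) * (1ℤ + k)
  step = ℤ-Solver.solve-∀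

-- A single quadratic covers both signs of j. Identities between exponents thereby become polynomial
-- identities over ℤ, from which the factor 2 is cancelled.
2*exponent : ∀ u v j → + 2 * + exponent u v j ≡ (+ u + + v) * (j * j) + (+ u - + v) * j
2*exponent u v (+ k)    =
    trans (2*progression (u ℕ.+ v) u k)
        (+-congˡ ((+ u + + v) * (+ k * + k)) (cong (_* + k) (diff (+ u) (+ v))))
  where
  diff : ∀ u v → + 2 * u - (u + v) ≡ u - v
  diff = ℤ-Solver.solve-∀
2*exponent u v -[1+ k ] = trans (2*progression (u ℕ.+ v) v (suc k)) (flip (+ u) (+ v) (+ suc k))
  where
  flip : ∀ u v k →
    (u + v) * (k * k) + (+ 2 * v - (u + v)) * k ≡ (u + v) * (- k * - k) + (u - v) * (- k)
  flip = ℤ-Solver.solve-∀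

exponent-step : ∀ u v j → + exponent u v j ≡ + exponent u v (j - 1ℤ) +
  (+ u + (+ u + + v) * (j - 1ℤ))
exponent-step u v j = ℤₚ.*-cancelˡ-≡ (+ 2) _ _ (begin
  + 2 * + exponent u v j
    ≡⟨ 2*exponent u v j ⟩
  (+ u + + v) * (j * j) + (+ u - + v) * j
    ≡⟨ step (+ u) (+ v) j ⟩
  (+ u + + v) * ((j - 1ℤ) * (j - 1ℤ)) + (+ u - + v) * (j - 1ℤ) +
      + 2 * (+ u + (+ u + + v) * (j - 1ℤ))
    ≡⟨ cong (_+ + 2 * (+ u + (+ u + + v) * (j - 1ℤ))) (2*exponent u v (j - 1ℤ)) ⟨
  + 2 * + exponent u v (j - 1ℤ) + + 2 * (+ u + (+ u + + v) * (j - 1ℤ))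
    ≡⟨ ℤₚ.*-distribˡ-+ (+ 2) (+ exponent u v (j - 1ℤ)) _ ⟨
  + 2 * (+ exponent u v (j - 1ℤ) + (+ u + (+ u + + v) * (j - 1ℤ))) ∎)
  where
  open ≡-Reasoning
  step : ∀ u v j → (u + v) * (j * j) + (u - v) * j ≡
    (u + v) * ((j - 1ℤ) * (j - 1ℤ)) + (u - v) * (j - 1ℤ) + + 2 * (u + (u + v) * (j - 1ℤ))
  step = ℤ-Solver.solve-∀

-- Balances the powers of q in `tripleCoeff-sucˡ`: the power of the new factor times that of the
-- coefficient at j - 1 is the power at j times the q^(s X) of the q-Pascal rule.
exponent-shift : ∀ u v a j {X} → + suc a - j ≡ + X →
  (u ℕ.+ (u ℕ.+ v) ℕ.* a) ℕ.+ exponent u v (j - 1ℤ) ≡ exponent u v j ℕ.+ (u ℕ.+ v) ℕ.* X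
exponent-shift u v a j {X} ex = ℤₚ.+-injective (begin
  + u + + (s ℕ.* a) + e                               ≡⟨ cong (λ z → + u + z + e) (ℤₚ.pos-* s a) ⟩
  + u + + s * + a + e                                 ≡⟨ rearrange (+ u) (+ s) (+ a) e j ⟩
  e + (+ u + + s * (j - 1ℤ)) + + s * (1ℤ + + a - j)
      ≡⟨ cong₂ _+_ (sym (exponent-step u v j)) (cong (λ x → + s * x) ex) ⟩
  + exponent u v j + + s * + X
      ≡⟨ +-congˡ (+ exponent u v j) (sym (ℤₚ.pos-* s X)) ⟩
  + exponent u v j + + (s ℕ.* X)                      ∎)
  where
  open ≡-Reasoning
  s : ℕ
  s = u ℕ.+ v
  e : ℤ
  e = + exponent u v (j - 1ℤ)
  rearrange : ∀ u S a e j → u + S * a + e ≡ e + (u + S * (j - 1ℤ)) + S * (1ℤ + a - j)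
  rearrange = ℤ-Solver.solve-∀

-- 1 / (q^s ; q^s)_m, which is 0 for negative m.
recipPoch : ℕ → ℤ → Series
recipPoch s (+ m)    = recip (poch s s m)
recipPoch s -[1+ _ ] = const 0ℤ

-- At X = 0 the factor 1 - q^0 vanishes, in agreement with the value 0 at index -1. Thanks to this
-- convention the q-Pascal rule holds up to the edge of the support.
recipPoch-pred : ∀ s X → 0 < s → recipPoch s (+ X - 1ℤ) ≈ (1ˢ ⊖ q^ (s ℕ.* X)) ⊗ recipPoch s (+ X)
recipPoch-pred s zero    0<s = begin
  const 0ℤ                          ≈⟨ ⊗-zeroˡ (recip 1ˢ) ⟨
  const 0ℤ ⊗ recip 1ˢ
      ≈⟨ ⊗-cong (≈-trans (⊖≈⊕⊝ 1ˢ 1ˢ) (CommutativeRing.-‿inverseʳ seriesRing 1ˢ)) ≈-refl ⟨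
  (1ˢ ⊖ 1ˢ) ⊗ recip 1ˢ
      ≈⟨ ⊗-cong (⊖-cong ≈-refl (≈-sym (≈-trans (≡⇒≈ (cong q^_ (ℕₚ.*-zeroʳ s))) q^zero))) ≈-refl ⟩
  (1ˢ ⊖ q^ (s ℕ.* 0)) ⊗ recip 1ˢ    ∎
  where open SetoidReasoning setoid
recipPoch-pred s (suc X) 0<s = ⊗-inverse-unique (⊗-recip (poch s s X) (poch-at0 s s X 0<s)) (begin
  poch s s X ⊗ ((1ˢ ⊖ q^ (s ℕ.* suc X)) ⊗ recip (poch s s (suc X)))
    ≈⟨ ⊗-assoc _ _ _ ⟨
  poch s s X ⊗ (1ˢ ⊖ q^ (s ℕ.* suc X)) ⊗ recip (poch s s (suc X))
    ≈⟨ ⊗-cong (≈-trans (⊗-comm (poch s s X) _)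
         (⊗-cong (⊖-cong ≈-refl (≡⇒≈ (cong q^_ (ℕₚ.*-suc s X)))) ≈-refl)) ≈-refl ⟩
  poch s s (suc X) ⊗ recip (poch s s (suc X))
    ≈⟨ ⊗-recip (poch s s (suc X)) (poch-at0 s s (suc X) 0<s) ⟩
  1ˢ ∎)
  where open SetoidReasoning setoid

-- The coefficient of z^j in
-- ∏_{t < a} (1 + z q^(u + (u+v) t)) ∏_{t < b} (1 + z⁻¹ q^(v + (u+v) t)).
tripleCoeff : (u v a b : ℕ) → ℤ → Series
tripleCoeff u v a b j =
  (q^ exponent u v j) ⊗ (poch s s (a ℕ.+ b) ⊗ (recipPoch s (+ a - j) ⊗ recipPoch s (+ b + j)))
  where
  s : ℕ
  s = u ℕ.+ v

private
  vanishˡ : ∀ f g {x} y → x ≈ const 0ℤ → f ⊗ (g ⊗ (x ⊗ y)) ≈ const 0ℤ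
  vanishˡ f g y p = ≈-trans (⊗-cong ≈-refl (⊗-cong ≈-refl (⊗-cong p ≈-refl)))
    (solve 3 (λ f g y → f :* (g :* (con 0ℤ :* y)) := con 0ℤ) ≈-refl f g y)
    where open Solver

  vanishʳ : ∀ f g x {y} → y ≈ const 0ℤ → f ⊗ (g ⊗ (x ⊗ y)) ≈ const 0ℤ
  vanishʳ f g x p = ≈-trans (⊗-cong ≈-refl (⊗-cong ≈-refl (⊗-comm x _))) (vanishˡ f g x p)

  0+0 : ∀ {f g} h → f ≈ const 0ℤ → g ≈ const 0ℤ → const 0ℤ ≈ f ⊕ h ⊗ g
  0+0 h p q = ≈-sym
      (≈-trans (⊕-cong p (≈-trans (⊗-cong ≈-refl q) (⊗-zeroʳ h))) (⊕-identityˡ (const 0ℤ)))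

tripleCoeff-zeroˡ : ∀ u v a b j k → + a - j ≡ -[1+ k ] → tripleCoeff u v a b j ≈ const 0ℤ
tripleCoeff-zeroˡ u v a b j k e =
  vanishˡ (q^ exponent u v j) _ _ (≡⇒≈ (cong (recipPoch (u ℕ.+ v)) e))

tripleCoeff-zeroʳ : ∀ u v a b j k → + b + j ≡ -[1+ k ] → tripleCoeff u v a b j ≈ const 0ℤ
tripleCoeff-zeroʳ u v a b j k e =
  vanishʳ (q^ exponent u v j) _ _ (≡⇒≈ (cong (recipPoch (u ℕ.+ v)) e))

-- The q-Pascal rule in base q^s. With X = a + 1 - j and Y = b + j one has X + Y = a + b + 1, and 1
-- - q^(s(X+Y)) = (1 - q^(sX)) + q^(sX) (1 - q^(sY)) splits the new factor of the numerator. If X or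
-- Y is negative, all three coefficients vanish.
tripleCoeff-sucˡ : ∀ u v a b j → 0 < u ℕ.+ v → tripleCoeff u v (suc a) b j ≈
  tripleCoeff u v a b j ⊕ (q^ (u ℕ.+ (u ℕ.+ v) ℕ.* a)) ⊗ tripleCoeff u v a b (j - 1ℤ)
tripleCoeff-sucˡ u v a b j 0<s = go (+ suc a - j) (+ b + j) refl refl
  where
  s : ℕ
  s = u ℕ.+ v
  x-1 : ∀ a j → a - j ≡ (1ℤ + a - j) - 1ℤ
  x-1 = ℤ-Solver.solve-∀
  x-same : ∀ a j → a - (j - 1ℤ) ≡ 1ℤ + a - j
  x-same = ℤ-Solver.solve-∀
  y-1 : ∀ b j → b + (j - 1ℤ) ≡ (b + j) - 1ℤ
  y-1 = ℤ-Solver.solve-∀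
  q^c : Series
  q^c = q^ (u ℕ.+ s ℕ.* a)
  go : ∀ x y → + suc a - j ≡ x → + b + j ≡ y → tripleCoeff u v (suc a) b j ≈
    tripleCoeff u v a b j ⊕ q^c ⊗ tripleCoeff u v a b (j - 1ℤ)
  go -[1+ k ] y ex ey = ≈-trans (tripleCoeff-zeroˡ u v (suc a) b j k ex)
    (0+0 q^c (tripleCoeff-zeroˡ u v a b j (suc k)
        (trans (x-1 (+ a) j) (trans (cong (_- 1ℤ) ex) (cong -[1+_] (cong suc (ℕₚ.+-identityʳ k))))))
             (tripleCoeff-zeroˡ u v a b (j - 1ℤ) k (trans (x-same (+ a) j) ex)))
  go (+ X) -[1+ k ] ex ey = ≈-trans (tripleCoeff-zeroʳ u v (suc a) b j k ey)
    (0+0 q^c (tripleCoeff-zeroʳ u v a b j k ey)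
             (tripleCoeff-zeroʳ u v a b (j - 1ℤ) (suc k)
                 (trans (y-1 (+ b) j)
                     (trans (cong (_- 1ℤ) ey) (cong -[1+_] (cong suc (ℕₚ.+-identityʳ k)))))))
  go (+ X) (+ Y) ex ey = begin
    E ⊗ ((1ˢ ⊖ q^ (s ℕ.+ s ℕ.* (a ℕ.+ b))) ⊗ P ⊗
        (recipPoch s (+ suc a - j) ⊗ recipPoch s (+ b + j)))
      ≈⟨ ⊗-cong ≈-refl (⊗-cong (⊗-cong (≈-trans (⊖-cong ≈-refl total) (⊖≈⊕⊝ 1ˢ _)) ≈-refl)
           (⊗-cong (≡⇒≈ (cong (recipPoch s) ex)) (≡⇒≈ (cong (recipPoch s) ey)))) ⟩
    E ⊗ ((1ˢ ⊕ ⊝ (qX ⊗ qY)) ⊗ P ⊗ (rX ⊗ rY))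
      ≈⟨ solve 6 (λ E P qX qY rX rY →
           E :* ((con 1ℤ :- qX :* qY) :* P :* (rX :* rY)) :=
           E :* (P :* ((con 1ℤ :- qX) :* rX :* rY)) :+ E :* qX :*
               (P :* (rX :* ((con 1ℤ :- qY) :* rY))))
           ≈-refl E P qX qY rX rY ⟩
    E ⊗ (P ⊗ ((1ˢ ⊕ ⊝ qX) ⊗ rX ⊗ rY)) ⊕ E ⊗ qX ⊗ (P ⊗ (rX ⊗ ((1ˢ ⊕ ⊝ qY) ⊗ rY)))
      ≈⟨ ⊕-cong (⊗-cong ≈-refl (⊗-cong ≈-refl (⊗-cong (⊗-cong (⊖≈⊕⊝ 1ˢ qX) ≈-refl) ≈-refl)))
                (⊗-cong ≈-refl (⊗-cong ≈-refl (⊗-cong ≈-refl (⊗-cong (⊖≈⊕⊝ 1ˢ qY) ≈-refl)))) ⟨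
    E ⊗ (P ⊗ ((1ˢ ⊖ qX) ⊗ rX ⊗ rY)) ⊕ E ⊗ qX ⊗ (P ⊗ (rX ⊗ ((1ˢ ⊖ qY) ⊗ rY)))
      ≈⟨ ⊕-cong (⊗-cong ≈-refl (⊗-cong ≈-refl (⊗-cong predX (≡⇒≈ (cong (recipPoch s) ey)))))
                (≈-trans (≈-sym (⊗-assoc q^c E′ _))
                  (⊗-cong shift (⊗-cong ≈-refl
                      (⊗-cong (≡⇒≈ (cong (recipPoch s) (trans (x-same (+ a) j) ex))) predY)))) ⟨
    tripleCoeff u v a b j ⊕ q^c ⊗ tripleCoeff u v a b (j - 1ℤ) ∎
    where
    open SetoidReasoning setoid
    open Solver
    E E′ P qX qY rX rY : Series
    E  = q^ exponent u v j
    E′ = q^ exponent u v (j - 1ℤ)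
    P  = poch s s (a ℕ.+ b)
    qX = q^ (s ℕ.* X)
    qY = q^ (s ℕ.* Y)
    rX = recipPoch s (+ X)
    rY = recipPoch s (+ Y)
    predX : recipPoch s (+ a - j) ≈ (1ˢ ⊖ qX) ⊗ rX
    predX = ≈-trans (≡⇒≈ (cong (recipPoch s) (trans (x-1 (+ a) j) (cong (_- 1ℤ) ex))))
        (recipPoch-pred s X 0<s)
    predY : recipPoch s (+ b + (j - 1ℤ)) ≈ (1ˢ ⊖ qY) ⊗ rY
    predY = ≈-trans (≡⇒≈ (cong (recipPoch s) (trans (y-1 (+ b) j) (cong (_- 1ℤ) ey))))
        (recipPoch-pred s Y 0<s)
    X+Y : X ℕ.+ Y ≡ suc (a ℕ.+ b)
    X+Y = ℤₚ.+-injective (trans (cong₂ _+_ (sym ex) (sym ey)) (cancel (+ a) (+ b) j))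
      where
      cancel : ∀ a b j → (1ℤ + a - j) + (b + j) ≡ 1ℤ + (a + b)
      cancel = ℤ-Solver.solve-∀
    total : q^ (s ℕ.+ s ℕ.* (a ℕ.+ b)) ≈ qX ⊗ qY
    total = ≈-trans (≡⇒≈ (cong q^_ (trans (sym (ℕₚ.*-suc s (a ℕ.+ b)))
      (trans (cong (s ℕ.*_) (sym X+Y)) (ℕₚ.*-distribˡ-+ s X Y))))) (q^-+ (s ℕ.* X) (s ℕ.* Y))
    shift : q^c ⊗ E′ ≈ E ⊗ qX
    shift = ≈-trans (≈-sym (q^-+ (u ℕ.+ s ℕ.* a) (exponent u v (j - 1ℤ))))
      (≈-trans (≡⇒≈ (cong q^_ (exponent-shift u v a j ex))) (q^-+ (exponent u v j) (s ℕ.* X)))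

-- The substitution of z⁻¹ for z exchanges the two halves of the product; it yields the recurrence
-- in b from the one in a.
tripleCoeff-neg : ∀ u v a b j → tripleCoeff u v a b j ≈ tripleCoeff v u b a (- j)
tripleCoeff-neg u v a b j = ⊗-cong (≡⇒≈ (cong q^_ (sym (exponent-neg v u j))))
  (⊗-cong (≡⇒≈ (cong₂ (λ s m → poch s s m) (ℕₚ.+-comm u v) (ℕₚ.+-comm a b)))
    (≈-trans (⊗-comm (recipPoch (u ℕ.+ v) (+ a - j)) (recipPoch (u ℕ.+ v) (+ b + j)))
      (⊗-cong (≡⇒≈ (cong₂ recipPoch (ℕₚ.+-comm u v) (+-congˡ (+ b) (sym (ℤₚ.neg-involutive j)))))
              (≡⇒≈ (cong (λ s → recipPoch s (+ a - j)) (ℕₚ.+-comm u v))))))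

tripleCoeff-sucʳ : ∀ u v a b j → 0 < u ℕ.+ v → tripleCoeff u v a (suc b) j ≈
  tripleCoeff u v a b j ⊕ (q^ (v ℕ.+ (u ℕ.+ v) ℕ.* b)) ⊗ tripleCoeff u v a b (j + 1ℤ)
tripleCoeff-sucʳ u v a b j 0<s = begin
  tripleCoeff u v a (suc b) j     ≈⟨ tripleCoeff-neg u v a (suc b) j ⟩
  tripleCoeff v u (suc b) a (- j)
      ≈⟨ tripleCoeff-sucˡ v u b a (- j) (subst (0 <_) (ℕₚ.+-comm u v) 0<s) ⟩
  tripleCoeff v u b a (- j) ⊕ (q^ (v ℕ.+ (v ℕ.+ u) ℕ.* b)) ⊗ tripleCoeff v u b a (- j - 1ℤ)
    ≈⟨ ⊕-cong (tripleCoeff-neg u v a b j)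
         (⊗-cong (≡⇒≈ (cong (λ s → q^ (v ℕ.+ s ℕ.* b)) (ℕₚ.+-comm u v)))
           (≈-trans (tripleCoeff-neg u v a b (j + 1ℤ))
               (≡⇒≈ (cong (tripleCoeff v u b a) (ℤₚ.neg-distrib-+ j 1ℤ))))) ⟨
  tripleCoeff u v a b j ⊕ (q^ (v ℕ.+ (u ℕ.+ v) ℕ.* b)) ⊗ tripleCoeff u v a b (j + 1ℤ) ∎
  where open SetoidReasoning setoid

recip-1ˢ : recip 1ˢ ≈ 1ˢ
recip-1ˢ = ≈-trans (≈-sym (⊗-identityˡ (recip 1ˢ))) (⊗-recip 1ˢ refl)

tripleCoeff-base : ∀ u v → tripleCoeff u v 0 0 0ℤ ≈ 1ˢ
tripleCoeff-base u v = begin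
  (q^ 0) ⊗ (1ˢ ⊗ (recip 1ˢ ⊗ recip 1ˢ))
      ≈⟨ ⊗-cong q^zero (⊗-cong ≈-refl (⊗-cong recip-1ˢ recip-1ˢ)) ⟩
  1ˢ ⊗ (1ˢ ⊗ (1ˢ ⊗ 1ˢ))
      ≈⟨ solve 0 (con 1ℤ :* (con 1ℤ :* (con 1ℤ :* con 1ℤ)) := con 1ℤ) ≈-refl ⟩
  1ˢ                                     ∎
  where
  open SetoidReasoning setoid
  open Solver

tripleCoeff-base-suc : ∀ u v k → tripleCoeff u v 0 0 (+ suc k) ≈ const 0ℤ
tripleCoeff-base-suc u v k = tripleCoeff-zeroˡ u v 0 0 (+ suc k) k refl

tripleCoeff-base-neg : ∀ u v k → tripleCoeff u v 0 0 -[1+ k ] ≈ const 0ℤ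
tripleCoeff-base-neg u v k = tripleCoeff-zeroʳ u v 0 0 -[1+ k ] k refl

-- MacMahon's products

Σˢ : {I : Set} → List I → (I → Series) → Series
Σˢ []      f = const 0ℤ
Σˢ (i ∷ L) f = f i ⊕ Σˢ L f

Σˢ-at : {I : Set} (L : List I) (f : I → Series) (N : ℕ) → Σˢ L f N ≡ sumOver L (λ i → f i N)
Σˢ-at []      f N = const-zero .at N
Σˢ-at (i ∷ L) f N = trans (⊕-at (f i) (Σˢ L f) N) (+-congˡ (f i N) (Σˢ-at L f N))

Σˢ-cong[] : ∀ {I : Set} {n} (L : List I) {f g : I → Series} →
  (∀ {i} → i ∈ L → f i ≈[ n ] g i) → Σˢ L f ≈[ n ] Σˢ L g
Σˢ-cong[] []      p = ≈[]-refl
Σˢ-cong[] (i ∷ L) p = ⊕-cong[] (p (here refl)) (Σˢ-cong[] L (λ i∈L → p (there i∈L)))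

Σˢ-cong∈ : ∀ {I : Set} (L : List I) {f g : I → Series} → (∀ {i} → i ∈ L → f i ≈ g i) →
  Σˢ L f ≈ Σˢ L g
Σˢ-cong∈ L p = ≈[]⇒≈ λ n → Σˢ-cong[] L (λ i∈L → ≈⇒≈[] (p i∈L))

Σˢ-cong : ∀ {I : Set} (L : List I) {f g : I → Series} → (∀ i → f i ≈ g i) → Σˢ L f ≈ Σˢ L g
Σˢ-cong L p = Σˢ-cong∈ L (λ {i} _ → p i)

Σˢ-++ : ∀ {I : Set} (L M : List I) (f : I → Series) → Σˢ (L ++ M) f ≈ Σˢ L f ⊕ Σˢ M f
Σˢ-++ []      M f = ≈-sym (⊕-identityˡ (Σˢ M f))
Σˢ-++ (i ∷ L) M f = ≈-trans (⊕-cong ≈-refl (Σˢ-++ L M f)) (≈-sym (⊕-assoc (f i) (Σˢ L f) (Σˢ M f)))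

Σˢ-map : ∀ {I J : Set} (h : J → I) (L : List J) (f : I → Series) →
  Σˢ (map h L) f ≈ Σˢ L (λ j → f (h j))
Σˢ-map h []      f = ≈-refl
Σˢ-map h (j ∷ L) f = ⊕-cong ≈-refl (Σˢ-map h L f)

Σˢ-⊕ : ∀ {I : Set} (L : List I) (f g : I → Series) → Σˢ L (λ i → f i ⊕ g i) ≈ Σˢ L f ⊕ Σˢ L g
Σˢ-⊕ []      f g = ≈-sym (⊕-identityˡ (const 0ℤ))
Σˢ-⊕ (i ∷ L) f g = ≈-trans (⊕-cong ≈-refl (Σˢ-⊕ L f g))
  (solve 4 (λ a b c d → a :+ b :+ (c :+ d) := a :+ c :+ (b :+ d)) ≈-refl (f i) (g i) (Σˢ L f)
      (Σˢ L g))
  where open Solver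

Σˢ-⊗ : ∀ {I : Set} (L : List I) (c : Series) (f : I → Series) → Σˢ L (λ i → c ⊗ f i) ≈ c ⊗ Σˢ L f
Σˢ-⊗ []      c f = ≈-sym (⊗-zeroʳ c)
Σˢ-⊗ (i ∷ L) c f = ≈-trans (⊕-cong ≈-refl (Σˢ-⊗ L c f))
  (solve 3 (λ c a b → c :* a :+ c :* b := c :* (a :+ b)) ≈-refl c (f i) (Σˢ L f))
  where open Solver

Σˢ-upTo-head : ∀ m (f : ℕ → Series) → Σˢ (upTo (suc m)) f ≈ f 0 ⊕ Σˢ (upTo m) (λ k → f (suc k))
Σˢ-upTo-head m f = ⊕-cong ≈-refl
  (≈-trans (≡⇒≈ (cong (λ L → Σˢ L f) (sym (map-upTo suc m)))) (Σˢ-map suc (upTo m) f))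

Σˢ-upTo-last : ∀ m (f : ℕ → Series) → Σˢ (upTo (suc m)) f ≈ Σˢ (upTo m) f ⊕ f m
Σˢ-upTo-last m f = ≈-trans (≡⇒≈ (cong (λ L → Σˢ L f) (sym (upTo-∷ʳ m))))
  (≈-trans (Σˢ-++ (upTo m) (m ∷ []) f)
      (⊕-cong ≈-refl (≈-trans (⊕-comm (f m) (const 0ℤ)) (⊕-identityˡ (f m)))))

-- The k-th elementary symmetric polynomial in W m, …, W (m + n - 1).
elementary : (W : ℕ → Series) (m n k : ℕ) → Series
elementary W m n       zero    = 1ˢ
elementary W m zero    (suc k) = const 0ℤ
elementary W m (suc n) (suc k) = W m ⊗ elementary W (suc m) n k ⊕ elementary W (suc m) n (suc k)

-- The definition splits off the first weight, as the enumeration of increasing tuples does;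
-- induction on the number of factors of a product splits off the last one instead.
elementary-last : ∀ W m n k →
  elementary W m (suc n) (suc k) ≈ elementary W m n (suc k) ⊕ W (m ℕ.+ n) ⊗ elementary W m n k
elementary-last W m zero k rewrite ℕₚ.+-identityʳ m =
  ≈-trans (⊕-comm _ (const 0ℤ)) (⊕-cong ≈-refl (⊗-cong ≈-refl (empty k)))
  where
  empty : ∀ k → elementary W (suc m) 0 k ≈ elementary W m 0 k
  empty zero    = ≈-refl
  empty (suc k) = ≈-refl
elementary-last W m (suc n) zero rewrite ℕₚ.+-suc m n =
  ≈-trans (⊕-cong ≈-refl (elementary-last W (suc m) n zero))
          (≈-sym (⊕-assoc (W m ⊗ 1ˢ) (elementary W (suc m) n 1) _))
elementary-last W m (suc n) (suc k) rewrite ℕₚ.+-suc m n =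
  ≈-trans (⊕-cong (⊗-cong ≈-refl (elementary-last W (suc m) n k))
      (elementary-last W (suc m) n (suc k)))
    (solve 5 (λ w z e₂ e₁ e₀ → w :* (e₁ :+ z :* e₀) :+ (e₂ :+ z :* e₁) :=
        w :* e₁ :+ e₂ :+ z :* (w :* e₀ :+ e₁))
      ≈-refl (W m) (W (suc (m ℕ.+ n))) (elementary W (suc m) n (suc (suc k)))
          (elementary W (suc m) n (suc k))
      (elementary W (suc m) n k))
  where open Solver

elementary-zero : ∀ W m {n k} → n < k → elementary W m n k ≈ const 0ℤ
elementary-zero W m {zero}  {suc k} _         = ≈-refl
elementary-zero W m {suc n} {suc k} (s≤s n<k) =
  ≈-trans (⊕-cong (≈-trans (⊗-cong ≈-refl (elementary-zero W (suc m) n<k)) (⊗-zeroʳ (W m)))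
                  (elementary-zero W (suc m) (ℕₚ.m<n⇒m<1+n n<k)))
          (⊕-identityˡ (const 0ℤ))

-- Extension by 0 to negative j makes Pascal's rule hold for every integer j.
choose : ℕ → ℤ → ℤ
choose n (+ j)    = + (n C j)
choose n -[1+ _ ] = 0ℤ

choose-suc : ∀ n j → choose (suc n) j ≡ choose n (j - 1ℤ) + choose n j
choose-suc n (+ zero)  = refl
choose-suc n (+ suc j) = cong +_ (sym (nCk+nC[k+1]≡[n+1]C[k+1] n j))
choose-suc n -[1+ j ]  = refl

-- The coefficient of z^α in (z + 2 + z⁻¹)^k.
central : ℕ → ℤ → ℤ
central k α = choose (2 ℕ.* k) (+ k + α)

-- Pascal's rule applied twice; on generating functions it is multiplication by z + 2 + z⁻¹.
central-suc : ∀ k α →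
  central (suc k) α ≡ central k (α - 1ℤ) + + 2 * central k α + central k (α + 1ℤ)
central-suc k α = begin
  choose (2 ℕ.* suc k) (+ suc k + α)       ≡⟨ cong (λ m → choose m j) (2*suc k) ⟩
  choose (suc (suc n)) j                   ≡⟨ choose-suc (suc n) j ⟩
  choose (suc n) (j - 1ℤ) + choose (suc n) j
    ≡⟨ cong₂ _+_ (choose-suc n (j - 1ℤ)) (choose-suc n j) ⟩
  choose n (j - 1ℤ - 1ℤ) + choose n (j - 1ℤ) + (choose n (j - 1ℤ) + choose n j)
    ≡⟨ collect (choose n (j - 1ℤ - 1ℤ)) (choose n (j - 1ℤ)) (choose n j) ⟩
  choose n (j - 1ℤ - 1ℤ) + + 2 * choose n (j - 1ℤ) + choose n j
    ≡⟨ cong₂ _+_ (cong₂ (λ x y → choose n x + + 2 * choose n y) (index₀ (+ k) α) (index₁ (+ k) α))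
                 (cong (choose n) (index₂ (+ k) α)) ⟩
  central k (α - 1ℤ) + + 2 * central k α + central k (α + 1ℤ) ∎
  where
  open ≡-Reasoning
  n : ℕ
  n = 2 ℕ.* k
  j : ℤ
  j = + suc k + α
  2*suc : ∀ k → 2 ℕ.* suc k ≡ suc (suc (2 ℕ.* k))
  2*suc = ℕ-Solver.solve-∀
  collect : ∀ a b c → a + b + (b + c) ≡ a + + 2 * b + c
  collect = ℤ-Solver.solve-∀
  index₀ : ∀ k α → 1ℤ + k + α - 1ℤ - 1ℤ ≡ k + (α - 1ℤ)
  index₀ = ℤ-Solver.solve-∀
  index₁ : ∀ k α → 1ℤ + k + α - 1ℤ ≡ k + α
  index₁ = ℤ-Solver.solve-∀
  index₂ : ∀ k α → 1ℤ + k + α ≡ k + (α + 1ℤ)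
  index₂ = ℤ-Solver.solve-∀

-- The coefficient of z^α in ∏_{t < n} (1 + (z + 2 + z⁻¹) W t).
macMahonCoeff : (W : ℕ → Series) (n : ℕ) → ℤ → Series
macMahonCoeff W n α = Σˢ (upTo (suc n)) (λ k → const (central k α) ⊗ elementary W 0 n k)

-- Multiplication by the factor 1 + (z + 2 + z⁻¹) W n: `elementary-last` supplies W n and
-- `central-suc` supplies z + 2 + z⁻¹.
macMahonCoeff-suc : ∀ W n α → macMahonCoeff W (suc n) α ≈ macMahonCoeff W n α ⊕
  W n ⊗ (macMahonCoeff W n (α - 1ℤ) ⊕ const (+ 2) ⊗ macMahonCoeff W n α ⊕
      macMahonCoeff W n (α + 1ℤ))
macMahonCoeff-suc W n α = begin
  Σˢ (upTo (suc (suc n))) (λ k → c k ⊗ elementary W 0 (suc n) k)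
    ≈⟨ Σˢ-upTo-head (suc n) _ ⟩
  c 0 ⊗ 1ˢ ⊕ Σˢ (upTo (suc n)) (λ k → c (suc k) ⊗ elementary W 0 (suc n) (suc k))
    ≈⟨ ⊕-cong ≈-refl (Σˢ-cong (upTo (suc n)) λ k → ≈-trans (⊗-cong ≈-refl (elementary-last W 0 n k))
         (≈-trans (distribute (c (suc k)) (e (suc k)) (W n) (e k))
             (⊕-cong ≈-refl (⊗-cong ≈-refl (expand k))))) ⟩
  c 0 ⊗ 1ˢ ⊕ Σˢ (upTo (suc n))
      (λ k → c (suc k) ⊗ e (suc k) ⊕ W n ⊗ (f₋ k ⊕ const (+ 2) ⊗ f₀ k ⊕ f₊ k))
    ≈⟨ ⊕-cong ≈-refl (Σˢ-⊕ (upTo (suc n)) _ _) ⟩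
  c 0 ⊗ 1ˢ ⊕ (Σˢ (upTo (suc n)) (λ k → c (suc k) ⊗ e (suc k)) ⊕
      Σˢ (upTo (suc n)) (λ k → W n ⊗ (f₋ k ⊕ const (+ 2) ⊗ f₀ k ⊕ f₊ k)))
    ≈⟨ ⊕-assoc _ _ _ ⟨
  c 0 ⊗ 1ˢ ⊕ Σˢ (upTo (suc n)) (λ k → c (suc k) ⊗ e (suc k)) ⊕
      Σˢ (upTo (suc n)) (λ k → W n ⊗ (f₋ k ⊕ const (+ 2) ⊗ f₀ k ⊕ f₊ k))
    -- With its head restored the first sum runs up to k = n + 1, where the elementary symmetric
    -- polynomial in only n weights is 0.
    ≈⟨ ⊕-cong (≈-trans (≈-sym (Σˢ-upTo-head (suc n) (λ k → c k ⊗ e k)))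
                (≈-trans (Σˢ-upTo-last (suc n) (λ k → c k ⊗ e k))
                  (≈-trans (⊕-cong ≈-refl
                      (≈-trans (⊗-cong ≈-refl (elementary-zero W 0 {n} ℕₚ.≤-refl)) (⊗-zeroʳ _)))
                    (≈-trans (⊕-comm _ _) (⊕-identityˡ _)))))
              (≈-trans (Σˢ-⊗ (upTo (suc n)) (W n) _)
                (⊗-cong ≈-refl (≈-trans (Σˢ-⊕ (upTo (suc n)) _ f₊)
                  (⊕-cong (≈-trans (Σˢ-⊕ (upTo (suc n)) f₋ _)
                      (⊕-cong ≈-refl (Σˢ-⊗ (upTo (suc n)) (const (+ 2)) f₀))) ≈-refl)))) ⟩
  macMahonCoeff W n α ⊕
    W n ⊗ (macMahonCoeff W n (α - 1ℤ) ⊕ const (+ 2) ⊗ macMahonCoeff W n α ⊕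
        macMahonCoeff W n (α + 1ℤ)) ∎
  where
  open SetoidReasoning setoid
  open Solver
  c e f₋ f₀ f₊ : ℕ → Series
  c k = const (central k α)
  e k = elementary W 0 n k
  f₋ k = const (central k (α - 1ℤ)) ⊗ e k
  f₀ k = c k ⊗ e k
  f₊ k = const (central k (α + 1ℤ)) ⊗ e k
  distribute : ∀ c e₁ w e₀ → c ⊗ (e₁ ⊕ w ⊗ e₀) ≈ c ⊗ e₁ ⊕ w ⊗ (c ⊗ e₀)
  distribute = solve 4 (λ c e₁ w e₀ → c :* (e₁ :+ w :* e₀) := c :* e₁ :+ w :* (c :* e₀)) ≈-refl
  expand : ∀ k → c (suc k) ⊗ e k ≈ f₋ k ⊕ const (+ 2) ⊗ f₀ k ⊕ f₊ k
  expand k = begin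
    c (suc k) ⊗ e k
      ≈⟨ ⊗-cong (≈-trans (≡⇒≈ (cong const (central-suc k α)))
           (≈-trans (const-⊕ _ _)
               (⊕-cong (≈-trans (const-⊕ _ _) (⊕-cong ≈-refl (const-⊗ (+ 2) _))) ≈-refl))) ≈-refl ⟩
    (const (central k (α - 1ℤ)) ⊕ const (+ 2) ⊗ c k ⊕ const (central k (α + 1ℤ))) ⊗ e k
      ≈⟨ solve 5 (λ t a b d e → (a :+ t :* b :+ d) :* e := a :* e :+ t :* (b :* e) :+ d :* e) ≈-refl
           (const (+ 2)) (const (central k (α - 1ℤ))) (c k) (const (central k (α + 1ℤ))) (e k) ⟩
    f₋ k ⊕ const (+ 2) ⊗ f₀ k ⊕ f₊ k ∎

-- The pairs (u , s) = (1 , 1) and (1 , 2) give the weights of A and C. Since t starts at 0, the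
-- summation index of the series is t + 1, and the exponents are t + 1 and 2t + 1.
macMahonWeight : (u s t : ℕ) → Series
macMahonWeight u s t = (q^ m) ⊗ recip ((1ˢ ⊖ q^ m) ⊗ (1ˢ ⊖ q^ m))
  where
  m : ℕ
  m = u ℕ.+ s ℕ.* t

-- The two Pochhammer factors clear the denominators of the weights. What remains is the coefficient
-- of z^α in ∏ (1 + z q^m)(1 + z⁻¹ q^m) over m = u + s t with t < n.
cleared : (u s n : ℕ) → ℤ → Series
cleared u s n α = poch u s n ⊗ poch u s n ⊗ macMahonCoeff (macMahonWeight u s) n α

-- (1 - y)² + (z + 2 + z⁻¹) y = (1 + z y)(1 + z⁻¹ y)
cleared-suc : ∀ u s n α → 0 < u → let y = q^ (u ℕ.+ s ℕ.* n) in
  cleared u s (suc n) α ≈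
    cleared u s n α ⊕ y ⊗ cleared u s n (α - 1ℤ) ⊕
        y ⊗ (cleared u s n (α + 1ℤ) ⊕ y ⊗ cleared u s n α)
cleared-suc u s n α 0<u = begin
  d ⊗ p ⊗ (d ⊗ p) ⊗ macMahonCoeff W (suc n) α
    ≈⟨ ⊗-cong ≈-refl (macMahonCoeff-suc W n α) ⟩
  d ⊗ p ⊗ (d ⊗ p) ⊗ (S₀ ⊕ y ⊗ r ⊗ (S₋ ⊕ const (+ 2) ⊗ S₀ ⊕ S₊))
    ≈⟨ solve 7 (λ d p y r S₀ S₋ S₊ →
        d :* p :* (d :* p) :* (S₀ :+ y :* r :* (S₋ :+ con (+ 2) :* S₀ :+ S₊)) :=
         d :* d :* (p :* p :* S₀) :+ d :* d :* r :*
              (p :* p :* (y :* (S₋ :+ con (+ 2) :* S₀ :+ S₊)))) ≈-refl d p y r S₀ S₋ S₊ ⟩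
  d ⊗ d ⊗ (p ⊗ p ⊗ S₀) ⊕ d ⊗ d ⊗ r ⊗ (p ⊗ p ⊗ (y ⊗ (S₋ ⊕ const (+ 2) ⊗ S₀ ⊕ S₊)))
    ≈⟨ ⊕-cong (⊗-cong (⊗-cong (⊖≈⊕⊝ 1ˢ y) (⊖≈⊕⊝ 1ˢ y)) ≈-refl)
        (⊗-cong (⊗-recip (d ⊗ d) (⊗-one-at0 {d} {d} d₀ d₀)) ≈-refl) ⟩
  (1ˢ ⊕ ⊝ y) ⊗ (1ˢ ⊕ ⊝ y) ⊗ (p ⊗ p ⊗ S₀) ⊕ 1ˢ ⊗ (p ⊗ p ⊗ (y ⊗ (S₋ ⊕ const (+ 2) ⊗ S₀ ⊕ S₊)))
    ≈⟨ solve 5 (λ p y S₀ S₋ S₊ →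
         (con 1ℤ :- y) :* (con 1ℤ :- y) :* (p :* p :* S₀) :+ con 1ℤ :*
              (p :* p :* (y :* (S₋ :+ con (+ 2) :* S₀ :+ S₊))) :=
         p :* p :* S₀ :+ y :* (p :* p :* S₋) :+ y :* (p :* p :* S₊ :+ y :* (p :* p :* S₀)))
              ≈-refl p y S₀ S₋ S₊ ⟩
  cleared u s n α ⊕ y ⊗ cleared u s n (α - 1ℤ) ⊕
      y ⊗ (cleared u s n (α + 1ℤ) ⊕ y ⊗ cleared u s n α) ∎
  where
  open SetoidReasoning setoid
  open Solver
  W : ℕ → Series
  W = macMahonWeight u s
  y d p r S₀ S₋ S₊ : Series
  y  = q^ (u ℕ.+ s ℕ.* n)
  d  = 1ˢ ⊖ y
  p  = poch u s n
  r  = recip (d ⊗ d)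
  S₀ = macMahonCoeff W n α
  S₋ = macMahonCoeff W n (α - 1ℤ)
  S₊ = macMahonCoeff W n (α + 1ℤ)
  d₀ : d 0 ≡ 1ℤ
  d₀ = 1-q^-at0 (u ℕ.+ s ℕ.* n) (ℕₚ.≤-trans 0<u (ℕₚ.m≤m+n u (s ℕ.* n)))

cleared-base : ∀ u s u′ v′ α → cleared u s 0 α ≈ tripleCoeff u′ v′ 0 0 α
cleared-base u s u′ v′ α = ≈-trans
  (solve 1 (λ c → con 1ℤ :* con 1ℤ :* (c :* con 1ℤ :+ con 0ℤ) := c) ≈-refl (const (central 0 α)))
  (go α)
  where
  open Solver
  go : ∀ α → const (central 0 α) ≈ tripleCoeff u′ v′ 0 0 α
  go (+ zero)  = ≈-sym (tripleCoeff-base u′ v′)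
  go (+ suc k) = ≈-sym (tripleCoeff-base-suc u′ v′ k)
  go -[1+ k ]  = ≈-sym (tripleCoeff-base-neg u′ v′ k)

-- Arranged in the shape of `cleared-suc`, to which it corresponds when x = y.
tripleCoeff-suc : ∀ u v a b j → 0 < u ℕ.+ v →
  let x = q^ (u ℕ.+ (u ℕ.+ v) ℕ.* a)
      y = q^ (v ℕ.+ (u ℕ.+ v) ℕ.* b)
      T = tripleCoeff u v a b
  in tripleCoeff u v (suc a) (suc b) j ≈ T j ⊕ x ⊗ T (j - 1ℤ) ⊕ y ⊗ (T (j + 1ℤ) ⊕ x ⊗ T j)
tripleCoeff-suc u v a b j 0<s = ≈-trans (tripleCoeff-sucʳ u v (suc a) b j 0<s)
  (⊕-cong (tripleCoeff-sucˡ u v a b j 0<s)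
    (⊗-cong ≈-refl (≈-trans (tripleCoeff-sucˡ u v a b (j + 1ℤ) 0<s)
      (⊕-cong ≈-refl (⊗-cong ≈-refl (≡⇒≈ (cong (tripleCoeff u v a b) (back j))))))))
  where
  back : ∀ j → j + 1ℤ - 1ℤ ≡ j
  back = ℤ-Solver.solve-∀

-- For u = v = 1 both new factors of the triple product carry q^(2n+1), so the odd MacMahon product
-- is already a complete triple product.
cleared-odd : ∀ n β → cleared 1 2 n β ≈ tripleCoeff 1 1 n n β
cleared-odd zero    β = cleared-base 1 2 1 1 β
cleared-odd (suc n) β = ≈-trans (cleared-suc 1 2 n β (s≤s z≤n))
  (≈-trans (⊕-cong (⊕-cong (cleared-odd n β) (⊗-cong ≈-refl (cleared-odd n (β - 1ℤ))))
                   (⊗-cong ≈-refl (⊕-cong (cleared-odd n (β + 1ℤ))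
                       (⊗-cong ≈-refl (cleared-odd n β)))))
    (≈-sym (tripleCoeff-suc 1 1 n n β (s≤s z≤n))))

-- Adding the shifted sum multiplies the product by the missing factor 1 + z⁻¹.
cleared-all : ∀ n α → cleared 1 1 n α ⊕ cleared 1 1 n (α + 1ℤ) ≈ tripleCoeff 1 0 n (suc n) α
cleared-all zero    α = ≈-trans
  (⊕-cong (cleared-base 1 1 1 0 α) (≈-trans (cleared-base 1 1 1 0 (α + 1ℤ))
    (≈-sym (≈-trans (⊗-cong q^zero ≈-refl) (⊗-identityˡ _)))))
  (≈-sym (tripleCoeff-sucʳ 1 0 0 0 α (s≤s z≤n)))
cleared-all (suc n) α = begin
  cleared 1 1 (suc n) α ⊕ cleared 1 1 (suc n) (α + 1ℤ)
    ≈⟨ ⊕-cong (cleared-suc 1 1 n α (s≤s z≤n)) (cleared-suc 1 1 n (α + 1ℤ) (s≤s z≤n)) ⟩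
  K α ⊕ y ⊗ K (α - 1ℤ) ⊕ y ⊗ (K (α + 1ℤ) ⊕ y ⊗ K α) ⊕
  (K (α + 1ℤ) ⊕ y ⊗ K (α + 1ℤ - 1ℤ) ⊕ y ⊗ (K (α + 1ℤ + 1ℤ) ⊕ y ⊗ K (α + 1ℤ)))
    ≈⟨ ⊕-cong ≈-refl (⊕-cong (⊕-cong ≈-refl (⊗-cong ≈-refl (≡⇒≈ (cong K (swap α))))) ≈-refl) ⟩
  K α ⊕ y ⊗ K (α - 1ℤ) ⊕ y ⊗ (K (α + 1ℤ) ⊕ y ⊗ K α) ⊕
  (K (α + 1ℤ) ⊕ y ⊗ K (α - 1ℤ + 1ℤ) ⊕ y ⊗ (K (α + 1ℤ + 1ℤ) ⊕ y ⊗ K (α + 1ℤ)))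
    ≈⟨ solve 6 (λ y a b c d e →
        a :+ y :* b :+ y :* (c :+ y :* a) :+ (c :+ y :* d :+ y :* (e :+ y :* c)) :=
         a :+ c :+ y :* (b :+ d) :+ y :* (c :+ e :+ y :* (a :+ c))) ≈-refl
         y (K α) (K (α - 1ℤ)) (K (α + 1ℤ)) (K (α - 1ℤ + 1ℤ)) (K (α + 1ℤ + 1ℤ)) ⟩
  K α ⊕ K (α + 1ℤ) ⊕ y ⊗ (K (α - 1ℤ) ⊕ K (α - 1ℤ + 1ℤ)) ⊕
    y ⊗ (K (α + 1ℤ) ⊕ K (α + 1ℤ + 1ℤ) ⊕ y ⊗ (K α ⊕ K (α + 1ℤ)))
    ≈⟨ ⊕-cong (⊕-cong (cleared-all n α) (⊗-cong ≈-refl (cleared-all n (α - 1ℤ))))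
              (⊗-cong ≈-refl (⊕-cong (cleared-all n (α + 1ℤ)) (⊗-cong ≈-refl (cleared-all n α)))) ⟩
  T α ⊕ y ⊗ T (α - 1ℤ) ⊕ y ⊗ (T (α + 1ℤ) ⊕ y ⊗ T α)
    -- Offsets 1 and 0 with lengths n and n + 1 give both new factors the same power q^(n+1) = y.
    ≈⟨ tripleCoeff-suc 1 0 n (suc n) α (s≤s z≤n) ⟨
  tripleCoeff 1 0 (suc n) (suc (suc n)) α ∎
  where
  open SetoidReasoning setoid
  open Solver
  K T : ℤ → Series
  K = cleared 1 1 n
  T = tripleCoeff 1 0 n (suc n)
  y : Series
  y = q^ (1 ℕ.+ 1 ℕ.* n)
  swap : ∀ α → α + 1ℤ - 1ℤ ≡ α - 1ℤ + 1ℤ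
  swap = ℤ-Solver.solve-∀

-- MacMahon's series

sumOver-cong∈ : {I : Set} (L : List I) {f g : I → ℤ} → (∀ {i} → i ∈ L → f i ≡ g i) →
  sumOver L f ≡ sumOver L g
sumOver-cong∈ []      e = refl
sumOver-cong∈ (i ∷ L) e = cong₂ _+_ (e (here refl)) (sumOver-cong∈ L λ i∈L → e (there i∈L))

-- Independence of a sum from the chosen support

module _ {I : Set} (_≟_ : DecidableEquality I) where

  δ : I → I → ℤ → ℤ
  δ i j x with i ≟ j
  ... | yes _ = x
  ... | no  _ = 0ℤ

  δ-≢ : ∀ {i j} x → ¬ i ≡ j → δ i j x ≡ 0ℤ
  δ-≢ {i} {j} x i≢j with i ≟ j
  ... | yes i≡j = ⊥-elim (i≢j i≡j)
  ... | no  _   = refl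

  δ-sym : ∀ (f : I → ℤ) i j → δ i j (f i) ≡ δ j i (f j)
  δ-sym f i j with i ≟ j | j ≟ i
  ... | yes refl | yes _   = refl
  ... | yes refl | no  j≢i = ⊥-elim (j≢i refl)
  ... | no  i≢j  | yes refl = ⊥-elim (i≢j refl)
  ... | no  _    | no  _   = refl

  sumOver-δ : ∀ {L} → Unique L → ∀ i x → (i ∉ L → x ≡ 0ℤ) → sumOver L (λ j → δ i j x) ≡ x
  sumOver-δ {[]}    []        i x out = sym (out λ ())
  sumOver-δ {j ∷ L} (j∉ ∷ u) i x out with i ≟ j
  ... | yes refl =
      trans (+-congˡ x (sumOver-zero L λ k∈L → δ-≢ x (All.lookup j∉ k∈L))) (ℤₚ.+-identityʳ x)
  ... | no  i≢j  = trans (ℤₚ.+-identityˡ _) (sumOver-δ u i x λ i∉L → out λ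
    { (here i≡j) → i≢j i≡j ; (there i∈L) → i∉L i∈L })

  sumOver-swap : ∀ (L M : List I) (f : I → I → ℤ) →
    sumOver L (λ i → sumOver M (f i)) ≡ sumOver M (λ j → sumOver L (λ i → f i j))
  sumOver-swap []      M f = sym (sumOver-zero M λ _ → refl)
  sumOver-swap (i ∷ L) M f = trans (+-congˡ (sumOver M (f i)) (sumOver-swap L M f))
    (sym (sumOver-+ M (f i) (λ j → sumOver L (λ i → f i j))))

  -- Both sums equal the double sum of f over the pairs (i , i).
  sumOver-support : ∀ {P : I → Set} {L M} (f : I → ℤ) → Unique L → Unique M → All P L → All P M →
    (∀ {i} → P i → i ∉ L → f i ≡ 0ℤ) → (∀ {i} → P i → i ∉ M → f i ≡ 0ℤ) →
    sumOver L f ≡ sumOver M f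
  sumOver-support {L = L} {M} f uL uM PL PM outL outM = begin
    sumOver L f
        ≡⟨ sumOver-cong∈ L (λ {i} i∈L → sym (sumOver-δ uM i (f i) (outM (All.lookup PL i∈L)))) ⟩
    sumOver L (λ i → sumOver M (λ j → δ i j (f i))) ≡⟨ sumOver-swap L M (λ i j → δ i j (f i)) ⟩
    sumOver M (λ j → sumOver L (λ i → δ i j (f i))) ≡⟨ sumOver-cong∈ M (λ {j} j∈M → trans
                                                        (sumOver-cong L (λ i → δ-sym f i j))
                                                        (sumOver-δ uL j (f j)
                                                            (outL (All.lookup PM j∈M)))) ⟩
    sumOver M f                                    ∎
    where open ≡-Reasoning

-- Replaces the support built into the definition of a series by whichever list suits the
-- computation.
∑-at : ∀ {I : Set} (_≟_ : DecidableEquality I) {P : I → Set} {f : I → Series}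
  (lf : LocallyFinite P f) N {M} →
  Unique M → All P M → (∀ {i} → P i → i ∉ M → f i N ≡ 0ℤ) → ∑ P f lf N ≡ sumOver M (λ i → f i N)
∑-at _≟_ {f = f} lf N uM PM outM =
  sumOver-support _≟_ (λ i → f i N) (unique lf N) uM (inside lf N) PM (complete lf N) outM

sumOver-filter : ∀ {I : Set} {P : I → Set} (P? : Decidable P) (L : List I) (f : I → ℤ) →
  (∀ i → ¬ P i → f i ≡ 0ℤ) → sumOver (filter P? L) f ≡ sumOver L f
sumOver-filter P? []      f z = refl
sumOver-filter P? (i ∷ L) f z with P? i
... | yes _  = +-congˡ (f i) (sumOver-filter P? L f z)
... | no  ¬p = trans (sumOver-filter P? L f z)
    (sym (trans (cong (_+ sumOver L f) (z i ¬p)) (ℤₚ.+-identityˡ _)))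

-- The entries lie in m + 1, ..., m + n. Splitting by whether m + 1 is the first entry mirrors the
-- recursion of `elementary`.
increasing : (m n k : ℕ) → List (Vec ℕ k)
increasing m n       zero    = [] ∷ []
increasing m zero    (suc k) = []
increasing m (suc n) (suc k) =
    map (suc m ∷_) (increasing (suc m) n k) ++ increasing (suc m) n (suc k)

linked-weaken : ∀ {m k} {t : Vec ℕ k} → Linked _<_ (suc m ∷ t) → Linked _<_ (m ∷ t)
linked-weaken [-]      = [-]
linked-weaken (p ∷ ps) = ℕₚ.<⇒≤ p ∷ ps

increasing-linked : ∀ m n k → All (λ t → Linked _<_ (m ∷ t)) (increasing m n k)
increasing-linked m n       zero    = [-] ∷ []
increasing-linked m zero    (suc k) = []
increasing-linked m (suc n) (suc k) = Allₚ.++⁺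
  (Allₚ.map⁺ (All.map (λ l → ℕₚ.≤-refl ∷ l) (increasing-linked (suc m) n k)))
  (All.map linked-weaken (increasing-linked (suc m) n (suc k)))

increasing-unique : ∀ m n k → Unique (increasing m n k)
increasing-unique m n       zero    = [] ∷ []
increasing-unique m zero    (suc k) = []
increasing-unique m (suc n) (suc k) = Uniq.++⁺
  (Uniq.map⁺ ∷-injectiveʳ (increasing-unique (suc m) n k))
      (increasing-unique (suc m) n (suc k)) disjoint
  where
  disjoint : ∀ {t} →
    t ∈ map (suc m ∷_) (increasing (suc m) n k) × t ∈ increasing (suc m) n (suc k) → _
  disjoint (t∈₁ , t∈₂) with ∈-map⁻ (suc m ∷_) t∈₁
  ... | _ , _ , refl with All.lookup (increasing-linked (suc m) n (suc k)) t∈₂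
  ...   | 1+m<1+m ∷ _ = ⊥-elim (ℕₚ.<-irrefl refl 1+m<1+m)

-- Every entry is at most the sum, and it is the sum that bounds the order of a term from below.
∈-increasing : ∀ m n {k} (t : Vec ℕ k) → Linked _<_ (m ∷ t) → Vec.sum t ≤ m ℕ.+ n →
  t ∈ increasing m n k
∈-increasing m n       []       _         _   = here refl
∈-increasing m zero    (x ∷ xs) (m<x ∷ _) s≤m = ⊥-elim (ℕₚ.<⇒≱ m<x
  (ℕₚ.≤-trans (ℕₚ.m≤m+n x (Vec.sum xs)) (ℕₚ.≤-trans s≤m (ℕₚ.≤-reflexive (ℕₚ.+-identityʳ m)))))
∈-increasing m (suc n) (x ∷ xs) (m<x ∷ l) s≤ with suc m ℕₚ.≟ x
... | yes refl = ∈-++⁺ˡ (∈-map⁺ (suc m ∷_) (∈-increasing (suc m) n xs l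
  (ℕₚ.≤-trans (ℕₚ.m≤n+m (Vec.sum xs) (suc m)) (ℕₚ.≤-trans s≤ (ℕₚ.≤-reflexive (ℕₚ.+-suc m n))))))
... | no 1+m≢x = ∈-++⁺ʳ (map (suc m ∷_) (increasing (suc m) n _)) (∈-increasing (suc m) n (x ∷ xs)
  (ℕₚ.≤∧≢⇒< m<x 1+m≢x ∷ l) (ℕₚ.≤-trans s≤ (ℕₚ.≤-reflexive (ℕₚ.+-suc m n))))

-- Isolates what `termA` and `termC` share: a term is the product of the weights of its entries, the
-- entry m + 1 having weight W m.
module _ (term : ∀ {k} → Vec ℕ k → Series) (W : ℕ → Series) (term-[] : term [] ≈ 1ˢ)
  (term-∷ : ∀ m {k} {t : Vec ℕ k} → Linked _<_ (suc m ∷ t) → term (suc m ∷ t) ≈ W m ⊗ term t) where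

  Σˢ-increasing : ∀ m n k → Σˢ (increasing m n k) term ≈ elementary W m n k
  Σˢ-increasing m n       zero    = ≈-trans (⊕-cong term-[] ≈-refl) (⊕-identityʳ 1ˢ)
  Σˢ-increasing m zero    (suc k) = ≈-refl
  Σˢ-increasing m (suc n) (suc k) = begin
    Σˢ (map (suc m ∷_) (increasing (suc m) n k) ++ increasing (suc m) n (suc k)) term
      ≈⟨ Σˢ-++ (map (suc m ∷_) (increasing (suc m) n k)) _ term ⟩
    Σˢ (map (suc m ∷_) (increasing (suc m) n k)) term ⊕ Σˢ (increasing (suc m) n (suc k)) term
      ≈⟨ ⊕-cong (≈-trans (Σˢ-map (suc m ∷_) (increasing (suc m) n k) term)
           (≈-trans (Σˢ-cong∈ (increasing (suc m) n k)
               (λ t∈ → term-∷ m (All.lookup (increasing-linked (suc m) n k) t∈)))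
             (Σˢ-⊗ (increasing (suc m) n k) (W m) term))) ≈-refl ⟩
    W m ⊗ Σˢ (increasing (suc m) n k) term ⊕ Σˢ (increasing (suc m) n (suc k)) term
      ≈⟨ ⊕-cong (⊗-cong ≈-refl (Σˢ-increasing (suc m) n k)) (Σˢ-increasing (suc m) n (suc k)) ⟩
    elementary W m (suc n) (suc k) ∎
    where open SetoidReasoning setoid

  -- A tuple missing from `increasing 0 n k` has sum above n, so its term vanishes modulo q^(n+1).
  ∑-tuples : ∀ k (lf : LocallyFinite Increasing (term {k})) →
    (∀ {t : Vec ℕ k} → Increasing t → OrderAtLeast (Vec.sum t) (term t)) →
    ∀ n → ∑ Increasing term lf ≈[ suc n ] elementary W 0 n k
  ∑-tuples k lf order n .at< N (s≤s N≤n) = trans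
    (∑-at (≡-dec ℕₚ._≟_) lf N (increasing-unique 0 n k) (increasing-linked 0 n k) out)
    (trans (sym (Σˢ-at (increasing 0 n k) term N)) (Σˢ-increasing 0 n k .at N))
    where
    out : ∀ {t} → Increasing t → t ∉ increasing 0 n k → term t N ≡ 0ℤ
    out {t} inc t∉ = outside {term t} (order inc) λ s≤N →
      ⊥-elim (t∉ (∈-increasing 0 n t inc (ℕₚ.≤-trans s≤N N≤n)))

recip-⊗-distrib : ∀ f g → f 0 ≡ 1ℤ → g 0 ≡ 1ℤ → recip (f ⊗ g) ≈ recip f ⊗ recip g
recip-⊗-distrib f g f₀ g₀ = ⊗-inverse-unique (⊗-recip (f ⊗ g) (⊗-one-at0 {f} {g} f₀ g₀))
  (≈-trans (solve 4 (λ f g r t → f :* g :* (r :* t) := f :* r :* (g :* t)) ≈-refl f g (recip f)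
      (recip g))
    (≈-trans (⊗-cong (⊗-recip f f₀) (⊗-recip g g₀)) (⊗-identityˡ 1ˢ)))
  where open Solver

recip-cong : ∀ {f g} → f 0 ≡ 1ℤ → g 0 ≡ 1ℤ → f ≈ g → recip f ≈ recip g
recip-cong f₀ g₀ p = ≈[]⇒≈ λ n → recip-cong[] f₀ g₀ (≈⇒≈[] p)

-ˢ≈⊖ : ∀ f g → f -ˢ g ≈ f ⊖ g
-ˢ≈⊖ f g = ≡⇒≈ (cong (λ op → op f g) (sym ⊖-def))

square≈ : ∀ f → f ^ˢ 2 ≈ f ⊗ f
square≈ f = ≈-trans (≈-sym (⊗≈*ˢ f (f ^ˢ 1)))
  (⊗-cong ≈-refl (≈-trans (≈-sym (⊗≈*ˢ f 1ˢ)) (⊗-identityʳ f)))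

-- The common shape of termA and termC: a monomial over a product of squares.
term-split : ∀ {a b c} u s m (d : Series) → d 0 ≡ 1ℤ → 0 < u → a ≡ u ℕ.+ s ℕ.* m →
  c ≡ u ℕ.+ s ℕ.* m ℕ.+ b →
  (q^ c) *ˢ recip ((1ˢ -ˢ q^ a) ^ˢ 2 *ˢ d) ≈ macMahonWeight u s m ⊗ ((q^ b) *ˢ recip d)
term-split {_} {b} u s m d d₀ 0<u refl refl = begin
  (q^ (e ℕ.+ b)) *ˢ recip ((1ˢ -ˢ q^ e) ^ˢ 2 *ˢ d)
    ≈⟨ ⊗≈*ˢ (q^ (e ℕ.+ b)) _ ⟨
  (q^ (e ℕ.+ b)) ⊗ recip ((1ˢ -ˢ q^ e) ^ˢ 2 *ˢ d)
    ≈⟨ ⊗-cong (q^-+ e b)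
        (≈-trans (recip-cong (trans (fact .at 0) h₀) h₀ fact) (recip-⊗-distrib (g ⊗ g) d g₀ d₀)) ⟩
  (q^ e) ⊗ (q^ b) ⊗ (recip (g ⊗ g) ⊗ recip d)
    ≈⟨ solve 4 (λ a b c d → a :* b :* (c :* d) := a :* c :* (b :* d)) ≈-refl (q^ e) (q^ b)
        (recip (g ⊗ g)) (recip d) ⟩
  (q^ e) ⊗ recip (g ⊗ g) ⊗ ((q^ b) ⊗ recip d)
    ≈⟨ ⊗-cong ≈-refl (⊗≈*ˢ (q^ b) (recip d)) ⟩
  macMahonWeight u s m ⊗ ((q^ b) *ˢ recip d) ∎
  where
  open SetoidReasoning setoid
  open Solver
  e : ℕ
  e = u ℕ.+ s ℕ.* m
  g : Series
  g = 1ˢ ⊖ q^ e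
  1-q₀ : g 0 ≡ 1ℤ
  1-q₀ = 1-q^-at0 e (ℕₚ.≤-trans 0<u (ℕₚ.m≤m+n u (s ℕ.* m)))
  g₀ : (g ⊗ g) 0 ≡ 1ℤ
  g₀ = ⊗-one-at0 {g} {g} 1-q₀ 1-q₀
  h₀ : (g ⊗ g ⊗ d) 0 ≡ 1ℤ
  h₀ = ⊗-one-at0 {g ⊗ g} {d} g₀ d₀
  fact : (1ˢ -ˢ q^ e) ^ˢ 2 *ˢ d ≈ g ⊗ g ⊗ d
  fact = ≈-trans (≈-sym (⊗≈*ˢ ((1ˢ -ˢ q^ e) ^ˢ 2) d))
    (⊗-cong (≈-trans (square≈ (1ˢ -ˢ q^ e)) (⊗-cong (-ˢ≈⊖ 1ˢ (q^ e)) (-ˢ≈⊖ 1ˢ (q^ e)))) ≈-refl)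

*ˢ-one-at0 : ∀ {f g} → f 0 ≡ 1ℤ → g 0 ≡ 1ℤ → (f *ˢ g) 0 ≡ 1ℤ
*ˢ-one-at0 {f} {g} f₀ g₀ = trans (sym (⊗≈*ˢ f g .at 0)) (⊗-one-at0 {f} {g} f₀ g₀)

square-at0 : ∀ a → 0 < a → ((1ˢ -ˢ q^ a) ^ˢ 2) 0 ≡ 1ℤ
square-at0 (suc a) _ = refl

denominatorA-at0 : ∀ {m k} {t : Vec ℕ k} → Linked _<_ (m ∷ t) → denominatorA t 0 ≡ 1ℤ
denominatorA-at0 [-]                       = refl
denominatorA-at0 {t = x ∷ t} (m<x ∷ l) =
  *ˢ-one-at0 {(1ˢ -ˢ q^ x) ^ˢ 2} {denominatorA t} (square-at0 x (ℕₚ.≤-trans (s≤s z≤n) m<x))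
      (denominatorA-at0 l)

2x∸1 : ∀ x → 2 ℕ.* suc x ∸ 1 ≡ 1 ℕ.+ 2 ℕ.* x
2x∸1 x = ℕₚ.+-suc x (x ℕ.+ 0)

denominatorC-at0 : ∀ {m k} {t : Vec ℕ k} → Linked _<_ (m ∷ t) → denominatorC t 0 ≡ 1ℤ
denominatorC-at0 [-]                            = refl
denominatorC-at0 {t = suc x ∷ t} (m<x ∷ l) =
  *ˢ-one-at0 {(1ˢ -ˢ q^ (2 ℕ.* suc x ∸ 1)) ^ˢ 2} {denominatorC t}
    (square-at0 (2 ℕ.* suc x ∸ 1) (subst (0 <_) (sym (2x∸1 x)) (s≤s z≤n))) (denominatorC-at0 l)

term-empty : (q^ 0) *ˢ recip 1ˢ ≈ 1ˢ
term-empty = ≈-trans (≈-sym (⊗≈*ˢ (q^ 0) (recip 1ˢ)))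
    (≈-trans (⊗-cong q^zero recip-1ˢ) (⊗-identityˡ 1ˢ))

termA-∷ : ∀ m {k} {t : Vec ℕ k} → Linked _<_ (suc m ∷ t) →
  termA (suc m ∷ t) ≈ macMahonWeight 1 1 m ⊗ termA t
termA-∷ m {t = t} l = term-split 1 1 m (denominatorA t) (denominatorA-at0 l) (s≤s z≤n) m≡
  (cong (ℕ._+ Vec.sum t) m≡)
  where
  m≡ : suc m ≡ 1 ℕ.+ 1 ℕ.* m
  m≡ = cong suc (sym (ℕₚ.*-identityˡ m))

termC-∷ : ∀ m {k} {t : Vec ℕ k} → Linked _<_ (suc m ∷ t) →
  termC (suc m ∷ t) ≈ macMahonWeight 1 2 m ⊗ termC t
termC-∷ m {k} {t} l =
    term-split 1 2 m (denominatorC t) (denominatorC-at0 l) (s≤s z≤n) (2x∸1 m) (begin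
  2 ℕ.* (suc m ℕ.+ Vec.sum t) ∸ suc k           ≡⟨ cong (_∸ suc k) (double m (Vec.sum t)) ⟩
  -- The truncated subtraction is exact here: the k remaining entries are positive, so k is at most
  -- their sum.
  1 ℕ.+ 2 ℕ.* m ℕ.+ 2 ℕ.* Vec.sum t ∸ k         ≡⟨ ℕₚ.+-∸-assoc (1 ℕ.+ 2 ℕ.* m) k≤2s ⟩
  1 ℕ.+ 2 ℕ.* m ℕ.+ (2 ℕ.* Vec.sum t ∸ k)       ∎)
  where
  open ≡-Reasoning
  double : ∀ m s → 2 ℕ.* (suc m ℕ.+ s) ≡ suc (1 ℕ.+ 2 ℕ.* m ℕ.+ 2 ℕ.* s)
  double = ℕ-Solver.solve-∀
  k≤2s : k ≤ 2 ℕ.* Vec.sum t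
  k≤2s = ℕₚ.≤-trans (k≤sum l) (ℕₚ.m≤m+n (Vec.sum t) _)

𝒜≈elementary : ∀ k n → 𝒜 k ≈[ suc n ] elementary (macMahonWeight 1 1) 0 n k
𝒜≈elementary k =
    ∑-tuples termA (macMahonWeight 1 1) term-empty termA-∷ k (termA-locallyFinite k)
        (λ {t} _ → termA-order t)

𝒞≈elementary : ∀ k n → 𝒞 k ≈[ suc n ] elementary (macMahonWeight 1 2) 0 n k
𝒞≈elementary k =
    ∑-tuples termC (macMahonWeight 1 2) term-empty termC-∷ k (termC-locallyFinite k) termC-order

-- For α below -k the absolute value in `binomial` can produce a nonzero number where `central` is
-- 0, so the bound on α matters.
binomial≡central : ∀ k α → ∣ α ∣ ≤ k → binomial k α ≡ central k α
binomial≡central k (+ a)    _         = refl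
binomial≡central k -[1+ a ] a<k rewrite ℤₚ.⊖-≥ a<k = refl

central-zero : ∀ k α → ¬ ∣ α ∣ ≤ k → central k α ≡ 0ℤ
central-zero k (+ a)    α≰k =
    cong +_ (k>n⇒nCk≡0 (subst (_< k ℕ.+ a) (2k k) (ℕₚ.+-monoʳ-< k (ℕₚ.≰⇒> α≰k))))
  where
  2k : ∀ k → k ℕ.+ k ≡ 2 ℕ.* k
  2k = ℕ-Solver.solve-∀
central-zero k -[1+ a ] α≰k rewrite ℤₚ.⊖-< (ℕₚ.≰⇒> α≰k) with suc a ∸ k | ℕₚ.m<n⇒0<n∸m (ℕₚ.≰⇒> α≰k)
... | suc _ | _ = refl

-- Modulo q^(n+1) only k ≤ n contribute, because F k has order at least k. The indices k < ∣ α ∣ may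
-- be added since `central k α` is 0 there.
binomialSum≈macMahonCoeff : ∀ F o W → (∀ k n → F k ≈[ suc n ] elementary W 0 n k) →
  ∀ α n → binomialSum F o α ≈[ suc n ] macMahonCoeff W n α
binomialSum≈macMahonCoeff F o W F≈ α n .at< N (s≤s N≤n) = begin
  binomialSum F o α N
    ≡⟨ ∑-at ℕₚ._≟_ (binomialTerm-locallyFinite F o α) N (Uniq.filter⁺ P? (Uniq.upTo⁺ (suc n)))
        (Allₚ.all-filter P? (upTo (suc n))) out ⟩
  sumOver (filter P? (upTo (suc n))) (λ k → binomialTerm F α k N)
    ≡⟨ sumOver-cong∈ (filter P? (upTo (suc n))) (λ {k} k∈ → trans (cong (λ b → (const b *ˢ F k) N)
         (binomial≡central k α (All.lookup (Allₚ.all-filter P? (upTo (suc n))) k∈)))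
             (const-*ˢ (central k α) (F k) .at N)) ⟩
  sumOver (filter P? (upTo (suc n))) (λ k → central k α * F k N)
    ≡⟨ sumOver-filter P? (upTo (suc n)) (λ k → central k α * F k N)
        (λ k α≰k → 0*-zero (F k N) (central-zero k α α≰k)) ⟩
  sumOver (upTo (suc n)) (λ k → central k α * F k N)
    ≡⟨ sumOver-cong (upTo (suc n))
        (λ k → trans (cong (λ x → central k α * x) (F≈ k n .at< N (s≤s N≤n)))
         (sym (const-⊗-at (central k α) (elementary W 0 n k) N))) ⟩
  sumOver (upTo (suc n)) (λ k → (const (central k α) ⊗ elementary W 0 n k) N)
    ≡⟨ Σˢ-at (upTo (suc n)) (λ k → const (central k α) ⊗ elementary W 0 n k) N ⟨
  macMahonCoeff W n α N ∎
  where
  open ≡-Reasoning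
  P? : Decidable (∣ α ∣ ≤_)
  P? = ∣ α ∣ ℕₚ.≤?_
  out : ∀ {k} → ∣ α ∣ ≤ k → k ∉ filter P? (upTo (suc n)) → binomialTerm F α k N ≡ 0ℤ
  out {k} α≤k k∉ = outside {binomialTerm F α k} (*ˢ-orderʳ (const (binomial k α)) (F k) (o k))
    λ k≤N → ⊥-elim (k∉ (∈-filter⁺ P? (∈-upTo⁺ (s≤s (ℕₚ.≤-trans k≤N N≤n))) α≤k))

-- Limits and the pentagonal number theorem

-- Ensures that the index a - j of `recipPoch` is a natural number of size at least n, where the
-- finite product agrees with the infinite one modulo q^n.
sub-bound : ∀ n j {a} → n ℕ.+ ∣ j ∣ ≤ a → Σ ℕ λ X → + a - j ≡ + X × n ≤ X
sub-bound n (+ k) {a} n+k≤a = a ∸ k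
  , trans (ℤₚ.m-n≡m⊖n a k) (ℤₚ.⊖-≥ (ℕₚ.≤-trans (ℕₚ.m≤n+m k n) n+k≤a))
  , ℕₚ.m+n≤o⇒m≤o∸n n n+k≤a
sub-bound n -[1+ k ] {a} n+k≤a = a ℕ.+ suc k , refl
  , ℕₚ.≤-trans (ℕₚ.m≤m+n n (suc k)) (ℕₚ.≤-trans n+k≤a (ℕₚ.m≤m+n a (suc k)))

add-bound : ∀ n j {b} → n ℕ.+ ∣ j ∣ ≤ b → Σ ℕ λ Y → + b + j ≡ + Y × n ≤ Y
add-bound n j {b} n+j≤b with sub-bound n (- j) {b}
    (subst (λ k → n ℕ.+ k ≤ b) (sym (ℤₚ.∣-i∣≡∣i∣ j)) n+j≤b)
... | Y , e , n≤Y = Y , trans (+-congˡ (+ b) (sym (ℤₚ.neg-involutive j))) e , n≤Y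

-- All three finite products tend to the same p = (q^(u+v) ; q^(u+v))_∞, and p · p⁻¹ · p⁻¹ = p⁻¹.
-- The parameter s is u + v - 1, following the convention of `poch∞`.
tripleCoeff-limit : ∀ u v s → u ℕ.+ v ≡ suc s → ∀ n j {a b} → n ℕ.+ ∣ j ∣ ≤ a → n ℕ.+ ∣ j ∣ ≤ b →
  tripleCoeff u v a b j ≈[ n ] (q^ exponent u v j) ⊗ recip (poch∞ (suc s) s)
tripleCoeff-limit u v s u+v n j {a} {b} ha hb with sub-bound n j ha | add-bound n j hb
... | X , eX , n≤X | Y , eY , n≤Y rewrite u+v | eX | eY = ⊗-cong[] ≈[]-refl (begin
  poch (suc s) (suc s) (a ℕ.+ b) ⊗ (recip (poch (suc s) (suc s) X) ⊗ recip (poch (suc s) (suc s) Y))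
    ≈⟨ ⊗-cong[] (poch≈[]poch∞ (suc s) s
        (ℕₚ.≤-trans (ℕₚ.m≤m+n n ∣ j ∣) (ℕₚ.≤-trans ha (ℕₚ.m≤m+n a b))))
            (⊗-cong[] (limit n≤X) (limit n≤Y)) ⟩
  p ⊗ (recip p ⊗ recip p)  ≈⟨ ≈⇒≈[] (≈-sym (⊗-assoc p (recip p) (recip p))) ⟩
  p ⊗ recip p ⊗ recip p    ≈⟨ ≈⇒≈[] (⊗-cong (⊗-recip p p₀) ≈-refl) ⟩
  1ˢ ⊗ recip p             ≈⟨ ≈⇒≈[] (⊗-identityˡ (recip p)) ⟩
  recip p                  ∎)
  where
  open SetoidReasoning setoid[ n ]
  p : Series
  p = poch∞ (suc s) s
  p₀ : p 0 ≡ 1ℤ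
  p₀ = poch∞-at0 (suc s) s (s≤s z≤n)
  limit : ∀ {m} → n ≤ m → recip (poch (suc s) (suc s) m) ≈[ n ] recip p
  limit {m} n≤m = recip-cong[] (poch-at0 (suc s) (suc s) m (s≤s z≤n)) p₀
      (poch≈[]poch∞ (suc s) s n≤m)

-- r = 1/(q;q)_∞, ρ = 1/(q;q²)_∞ and σ = 1/(q²;q²)_∞
r ρ σ : Series
r = recip (poch∞ 1 0)
ρ = recip (poch∞ 1 1)
σ = recip (poch∞ 2 1)

divide-square : ∀ p f g → p 0 ≡ 1ℤ → p ⊗ p ⊗ f ≈ g → f ≈ recip p ⊗ recip p ⊗ g
divide-square p f g p₀ e = ≈-sym (begin
  recip p ⊗ recip p ⊗ g                    ≈⟨ ⊗-cong ≈-refl e ⟨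
  recip p ⊗ recip p ⊗ (p ⊗ p ⊗ f)
      ≈⟨ solve 3 (λ r p f → r :* r :* (p :* p :* f) := p :* r :* (p :* r) :* f) ≈-refl
          (recip p) p f ⟩
  p ⊗ recip p ⊗ (p ⊗ recip p) ⊗ f          ≈⟨ ⊗-cong (⊗-cong (⊗-recip p p₀) (⊗-recip p p₀)) ≈-refl ⟩
  1ˢ ⊗ 1ˢ ⊗ f                              ≈⟨ ⊗-cong (⊗-identityˡ 1ˢ) ≈-refl ⟩
  1ˢ ⊗ f                                   ≈⟨ ⊗-identityˡ f ⟩
  f                                        ∎)
  where
  open SetoidReasoning setoid
  open Solver

𝒜-sum 𝒞-sum : ℤ → Series
𝒜-sum = binomialSum 𝒜 𝒜-order
𝒞-sum = binomialSum 𝒞 𝒞-order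

𝒜-sum≈[]cleared : ∀ n α {m} → n ≤ m → poch∞ 1 0 ⊗ poch∞ 1 0 ⊗ 𝒜-sum α ≈[ n ] cleared 1 1 m α
𝒜-sum≈[]cleared n α {m} n≤m = ⊗-cong[] (⊗-cong[] p p)
  (≈[]-weaken (ℕₚ.m≤n⇒m≤1+n n≤m)
      (binomialSum≈macMahonCoeff 𝒜 𝒜-order (macMahonWeight 1 1) 𝒜≈elementary α m))
  where
  p : poch∞ 1 0 ≈[ n ] poch 1 1 m
  p = ≈[]-sym (poch≈[]poch∞ 1 0 n≤m)

𝒞-sum≈[]cleared : ∀ n β {m} → n ≤ m → poch∞ 1 1 ⊗ poch∞ 1 1 ⊗ 𝒞-sum β ≈[ n ] cleared 1 2 m β
𝒞-sum≈[]cleared n β {m} n≤m = ⊗-cong[] (⊗-cong[] p p)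
  (≈[]-weaken (ℕₚ.m≤n⇒m≤1+n n≤m)
      (binomialSum≈macMahonCoeff 𝒞 𝒞-order (macMahonWeight 1 2) 𝒞≈elementary β m))
  where
  p : poch∞ 1 1 ≈[ n ] poch 1 2 m
  p = ≈[]-sym (poch≈[]poch∞ 1 1 n≤m)

𝒜-sum-pair : ∀ α → 𝒜-sum α ⊕ 𝒜-sum (α + 1ℤ) ≈ r ⊗ r ⊗ ((q^ exponent 1 0 α) ⊗ r)
𝒜-sum-pair α = divide-square p (𝒜-sum α ⊕ 𝒜-sum (α + 1ℤ)) _ (poch∞-at0 1 0 (s≤s z≤n)) (≈[]⇒≈ λ n →
  -- The surplus ∣ α ∣ keeps both m - α and m + 1 + α at least n, as the limit requires.
  let m   = n ℕ.+ ∣ α ∣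
      n≤m = ℕₚ.m≤m+n n ∣ α ∣
      open SetoidReasoning setoid[ n ]
  in begin
  p ⊗ p ⊗ (𝒜-sum α ⊕ 𝒜-sum (α + 1ℤ))
    ≈⟨ ≈⇒≈[] (solve 3 (λ p a b → p :* p :* (a :+ b) := p :* p :* a :+ p :* p :* b) ≈-refl p
        (𝒜-sum α) (𝒜-sum (α + 1ℤ))) ⟩
  p ⊗ p ⊗ 𝒜-sum α ⊕ p ⊗ p ⊗ 𝒜-sum (α + 1ℤ)
    ≈⟨ ⊕-cong[] (𝒜-sum≈[]cleared n α n≤m) (𝒜-sum≈[]cleared n (α + 1ℤ) n≤m) ⟩
  cleared 1 1 m α ⊕ cleared 1 1 m (α + 1ℤ)
    ≈⟨ ≈⇒≈[] (cleared-all m α) ⟩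
  tripleCoeff 1 0 m (suc m) α
    ≈⟨ tripleCoeff-limit 1 0 0 refl n α ℕₚ.≤-refl (ℕₚ.n≤1+n m) ⟩
  (q^ exponent 1 0 α) ⊗ r ∎)
  where
  open Solver
  p : Series
  p = poch∞ 1 0

𝒞-sum-closed : ∀ β → 𝒞-sum β ≈ ρ ⊗ ρ ⊗ ((q^ exponent 1 1 β) ⊗ σ)
𝒞-sum-closed β = divide-square (poch∞ 1 1) (𝒞-sum β) _ (poch∞-at0 1 1 (s≤s z≤n)) (≈[]⇒≈ λ n →
  ≈[]-trans (𝒞-sum≈[]cleared n β (ℕₚ.m≤m+n n ∣ β ∣))
    (≈[]-trans (≈⇒≈[] (cleared-odd (n ℕ.+ ∣ β ∣) β))
      (tripleCoeff-limit 1 1 1 refl n β ℕₚ.≤-refl ℕₚ.≤-refl)))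

-- Sums over symmetric intervals, signs and the pentagonal series

Σˢ-zero : ∀ {I : Set} (L : List I) {f : I → Series} → (∀ i → f i ≈ const 0ℤ) → Σˢ L f ≈ const 0ℤ
Σˢ-zero []      z = ≈-refl
Σˢ-zero (i ∷ L) z = ≈-trans (⊕-cong (z i) (Σˢ-zero L z)) (⊕-identityˡ (const 0ℤ))

Σˢ-support : ∀ {I : Set} (_≟_ : DecidableEquality I) {L M : List I} {f : I → Series} → Unique L →
  Unique M →
  (∀ {i} → i ∉ L → f i ≈ const 0ℤ) → (∀ {i} → i ∉ M → f i ≈ const 0ℤ) → Σˢ L f ≈ Σˢ M f
Σˢ-support _≟_ {L} {M} {f} uL uM outL outM .at N = trans (Σˢ-at L f N) (trans
  (sumOver-support _≟_ (λ i → f i N) uL uM (All.universal (λ _ → tt) L) (All.universal (λ _ → tt) M)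
    (λ _ i∉ → trans (outL i∉ .at N) (const-zero .at N))
        (λ _ i∉ → trans (outM i∉ .at N) (const-zero .at N)))
  (sym (Σˢ-at M f N)))

-- Both the interval and its translate contain every j with ∣ j ∣ < B, and f vanishes at all other
-- j.
Σˢ-interval-shift : ∀ B d (f : ℤ → Series) → ∣ d ∣ ≤ 1 → (∀ j → B ≤ ∣ j ∣ → f j ≈ const 0ℤ) →
  Σˢ (interval B) (λ j → f (j + d)) ≈ Σˢ (interval B) f
Σˢ-interval-shift B d f d≤1 z = ≈-trans (≈-sym (Σˢ-map (_+ d) (interval B) f))
  (Σˢ-support ℤₚ._≟_ (Uniq.map⁺ (λ {i} {j} e → ∙-cancelʳ d i j e) (interval-unique B))
      (interval-unique B) out
    λ {j} j∉ → z j (ℕₚ.<⇒≤ (ℕₚ.≰⇒> λ j≤B → j∉ (∈-interval j j≤B))))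
  where
  out : ∀ {j} → j ∉ map (_+ d) (interval B) → f j ≈ const 0ℤ
  out {j} j∉ = z j (ℕₚ.≮⇒≥ λ j<B → j∉ (subst (_∈ map (_+ d) (interval B)) (back j d)
    (∈-map⁺ (_+ d) (∈-interval (j - d) (begin
      ∣ j - d ∣             ≤⟨ ℤₚ.∣i-j∣≤∣i∣+∣j∣ j d ⟩
      ∣ j ∣ ℕ.+ ∣ d ∣       ≤⟨ ℕₚ.+-monoʳ-≤ ∣ j ∣ d≤1 ⟩
      ∣ j ∣ ℕ.+ 1           ≡⟨ ℕₚ.+-comm ∣ j ∣ 1 ⟩
      suc ∣ j ∣             ≤⟨ j<B ⟩
      B                     ∎)))))
    where
    open ℕₚ.≤-Reasoning
    back : ∀ j d → j - d + d ≡ j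
    back = ℤ-Solver.solve-∀

-1^-suc : ∀ j → -1^ (j + 1ℤ) ≡ - -1^ j
-1^-suc (+ k)          rewrite ℕₚ.+-comm k 1 = ℤₚ.-1*i≡-i (-1ℤ ℤ.^ k)
-1^-suc -[1+ zero ]    = refl
-1^-suc -[1+ suc k ]   = sym (trans (cong -_ (ℤₚ.-1*i≡-i (-1ℤ * -1ℤ ℤ.^ k))) (ℤₚ.neg-involutive _))

-1^-pred : ∀ j → -1^ (j - 1ℤ) ≡ - -1^ j
-1^-pred j = trans (sym (ℤₚ.neg-involutive _))
    (cong -_ (trans (sym (-1^-suc (j - 1ℤ))) (cong -1^_ (back j))))
  where
  back : ∀ j → j - 1ℤ + 1ℤ ≡ j
  back = ℤ-Solver.solve-∀

-1^-+ : ∀ i j → -1^ (i + j) ≡ -1^ i * -1^ j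
-1^-+ i (+ zero)  = trans (cong -1^_ (ℤₚ.+-identityʳ i)) (sym (ℤₚ.*-identityʳ _))
-1^-+ i (+ suc k) = begin
  -1^ (i + + suc k)        ≡⟨ cong -1^_ (last i (+ k)) ⟩
  -1^ (i + + k + 1ℤ)       ≡⟨ -1^-suc (i + + k) ⟩
  - -1^ (i + + k)          ≡⟨ cong -_ (-1^-+ i (+ k)) ⟩
  - (-1^ i * -1^ (+ k))    ≡⟨ ℤₚ.neg-distribʳ-* (-1^ i) (-1^ (+ k)) ⟩
  -1^ i * - -1^ (+ k)      ≡⟨ cong (λ x → -1^ i * x) (ℤₚ.-1*i≡-i (-1^ (+ k))) ⟨
  -1^ i * -1^ (+ suc k)    ∎
  where
  open ≡-Reasoning
  last : ∀ i k → i + (1ℤ + k) ≡ i + k + 1ℤ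
  last = ℤ-Solver.solve-∀
-1^-+ i -[1+ zero ]  = trans (-1^-pred i) (trans (sym (ℤₚ.-1*i≡-i (-1^ i))) (ℤₚ.*-comm -1ℤ (-1^ i)))
-1^-+ i -[1+ suc k ] = begin
  -1^ (i + -[1+ suc k ])        ≡⟨ cong -1^_ (last i (+ suc k)) ⟩
  -1^ (i + -[1+ k ] - 1ℤ)       ≡⟨ -1^-pred (i + -[1+ k ]) ⟩
  - -1^ (i + -[1+ k ])          ≡⟨ cong -_ (-1^-+ i -[1+ k ]) ⟩
  - (-1^ i * -1^ -[1+ k ])      ≡⟨ ℤₚ.neg-distribʳ-* (-1^ i) (-1^ -[1+ k ]) ⟩
  -1^ i * - -1^ -[1+ k ]        ≡⟨ cong (λ x → -1^ i * x) (ℤₚ.-1*i≡-i (-1^ -[1+ k ])) ⟨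
  -1^ i * -1^ -[1+ suc k ]      ∎
  where
  open ≡-Reasoning
  last : ∀ i k → i + - (1ℤ + k) ≡ i + - k - 1ℤ
  last = ℤ-Solver.solve-∀

-1^-square : ∀ j → -1^ j * -1^ j ≡ 1ℤ
-1^-square j = trans (sym (ℤₚ.^-distribˡ-+-* -1ℤ ∣ j ∣ ∣ j ∣)) (go ∣ j ∣)
  where
  go : ∀ k → -1ℤ ℤ.^ (k ℕ.+ k) ≡ 1ℤ
  go zero    = refl
  go (suc k) rewrite ℕₚ.+-suc k k | go k = refl

tripleCoeff-outside : ∀ u v n j → n < ∣ j ∣ → tripleCoeff u v n n j ≈ const 0ℤ
tripleCoeff-outside u v n (+ k) n<k with k ∸ n in e | ℕₚ.m<n⇒0<n∸m n<k
... | suc i | _ = tripleCoeff-zeroˡ u v n n (+ k) i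
  (trans (ℤₚ.m-n≡m⊖n n k) (trans (ℤₚ.⊖-< n<k) (cong (λ x → - + x) e)))
tripleCoeff-outside u v n -[1+ k ] n<k with suc k ∸ n in e | ℕₚ.m<n⇒0<n∸m n<k
... | suc i | _ = tripleCoeff-zeroʳ u v n n -[1+ k ] i
  (trans (ℤₚ.⊖-< n<k) (cong (λ x → - + x) e))

-- Evaluation of the triple product at z = -1.
alternating-tripleCoeff : ∀ u v n {B} → 0 < u ℕ.+ v → n ≤ B →
  Σˢ (interval B) (λ j → const (-1^ j) ⊗ tripleCoeff u v n n j) ≈
      poch u (u ℕ.+ v) n ⊗ poch v (u ℕ.+ v) n
alternating-tripleCoeff u v zero {B} 0<s _ = begin
  Σˢ (interval B) f   ≈⟨ Σˢ-support ℤₚ._≟_ {interval B} {0ℤ ∷ []} {f} (interval-unique B) ([] ∷ [])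
                           (λ {j} j∉ → f-zero j λ { refl → j∉ (∈-interval {B} 0ℤ z≤n) })
                           (λ {j} j∉ → f-zero j λ { refl → j∉ (here refl) }) ⟩
  f 0ℤ ⊕ const 0ℤ     ≈⟨ ⊕-identityʳ (f 0ℤ) ⟩
  f 0ℤ                ≈⟨ ⊗-cong ≈-refl (tripleCoeff-base u v) ⟩
  1ˢ ⊗ 1ˢ             ∎
  where
  open SetoidReasoning setoid
  f : ℤ → Series
  f j = const (-1^ j) ⊗ tripleCoeff u v 0 0 j
  f-zero : ∀ j → ¬ j ≡ 0ℤ → f j ≈ const 0ℤ
  f-zero (+ zero)  j≢0 = ⊥-elim (j≢0 refl)
  f-zero (+ suc k) _   = ≈-trans (⊗-cong ≈-refl (tripleCoeff-base-suc u v k)) (⊗-zeroʳ _)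
  f-zero -[1+ k ]  _   = ≈-trans (⊗-cong ≈-refl (tripleCoeff-base-neg u v k)) (⊗-zeroʳ _)
alternating-tripleCoeff u v (suc n) {B} 0<s n<B = begin
  Σˢ (interval B) (λ j → const (-1^ j) ⊗ tripleCoeff u v (suc n) (suc n) j)
    ≈⟨ Σˢ-cong (interval B) term ⟩
  Σˢ (interval B) (λ j → (1ˢ ⊕ x ⊗ y) ⊗ f j ⊕ (⊝ x ⊗ f (j - 1ℤ) ⊕ ⊝ y ⊗ f (j + 1ℤ)))
    ≈⟨ ≈-trans (Σˢ-⊕ (interval B) _ _) (⊕-cong (Σˢ-⊗ (interval B) (1ˢ ⊕ x ⊗ y) f)
         (≈-trans (Σˢ-⊕ (interval B) _ _)
             (⊕-cong (Σˢ-⊗ (interval B) (⊝ x) _) (Σˢ-⊗ (interval B) (⊝ y) _)))) ⟩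
  (1ˢ ⊕ x ⊗ y) ⊗ Σˢ (interval B) f ⊕
    (⊝ x ⊗ Σˢ (interval B) (λ j → f (j - 1ℤ)) ⊕ ⊝ y ⊗ Σˢ (interval B) (λ j → f (j + 1ℤ)))
    ≈⟨ ⊕-cong (⊗-cong ≈-refl IH) (⊕-cong
         -- B stays fixed during the induction; since n < B, the support ∣ j ∣ ≤ n of f leaves room
         -- for a shift by one.
         (⊗-cong ≈-refl (≈-trans (Σˢ-interval-shift B -1ℤ f ℕₚ.≤-refl f-zero) IH))
         (⊗-cong ≈-refl (≈-trans (Σˢ-interval-shift B 1ℤ f ℕₚ.≤-refl f-zero) IH))) ⟩
  (1ˢ ⊕ x ⊗ y) ⊗ (p ⊗ p′) ⊕ (⊝ x ⊗ (p ⊗ p′) ⊕ ⊝ y ⊗ (p ⊗ p′))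
    ≈⟨ solve 4 (λ x y p p′ →
        (con 1ℤ :+ x :* y) :* (p :* p′) :+ (:- x :* (p :* p′) :+ :- y :* (p :* p′)) :=
         (con 1ℤ :- x) :* p :* ((con 1ℤ :- y) :* p′)) ≈-refl x y p p′ ⟩
  (1ˢ ⊕ ⊝ x) ⊗ p ⊗ ((1ˢ ⊕ ⊝ y) ⊗ p′)
    ≈⟨ ⊗-cong (⊗-cong (⊖≈⊕⊝ 1ˢ x) ≈-refl) (⊗-cong (⊖≈⊕⊝ 1ˢ y) ≈-refl) ⟨
  poch u (u ℕ.+ v) (suc n) ⊗ poch v (u ℕ.+ v) (suc n) ∎
  where
  open SetoidReasoning setoid
  open Solver
  f : ℤ → Series
  f j = const (-1^ j) ⊗ tripleCoeff u v n n j
  x y p p′ : Series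
  x  = q^ (u ℕ.+ (u ℕ.+ v) ℕ.* n)
  y  = q^ (v ℕ.+ (u ℕ.+ v) ℕ.* n)
  p  = poch u (u ℕ.+ v) n
  p′ = poch v (u ℕ.+ v) n
  IH : Σˢ (interval B) f ≈ p ⊗ p′
  IH = alternating-tripleCoeff u v n 0<s (ℕₚ.<⇒≤ n<B)
  f-zero : ∀ j → B ≤ ∣ j ∣ → f j ≈ const 0ℤ
  f-zero j B≤j = ≈-trans (⊗-cong ≈-refl (tripleCoeff-outside u v n j (ℕₚ.<-≤-trans n<B B≤j)))
      (⊗-zeroʳ _)
  sign : ∀ {a b} → a ≡ - b → const b ≈ ⊝ const a
  sign {a} {b} refl = ≈-trans (≡⇒≈ (cong const (sym (ℤₚ.neg-involutive b)))) (const-⊝ (- b))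
  term : ∀ j → const (-1^ j) ⊗ tripleCoeff u v (suc n) (suc n) j ≈
    (1ˢ ⊕ x ⊗ y) ⊗ f j ⊕ (⊝ x ⊗ f (j - 1ℤ) ⊕ ⊝ y ⊗ f (j + 1ℤ))
  term j = begin
    c ⊗ tripleCoeff u v (suc n) (suc n) j
      ≈⟨ ⊗-cong ≈-refl (tripleCoeff-suc u v n n j 0<s) ⟩
    c ⊗ (T j ⊕ x ⊗ T (j - 1ℤ) ⊕ y ⊗ (T (j + 1ℤ) ⊕ x ⊗ T j))
      ≈⟨ solve 6 (λ c x y a b d → c :* (a :+ x :* b :+ y :* (d :+ x :* a)) :=
           (con 1ℤ :+ x :* y) :* (c :* a) :+ (x :* (c :* b) :+ y :* (c :* d))) ≈-refl c x y (T j)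
               (T (j - 1ℤ)) (T (j + 1ℤ)) ⟩
    (1ˢ ⊕ x ⊗ y) ⊗ f j ⊕ (x ⊗ (c ⊗ T (j - 1ℤ)) ⊕ y ⊗ (c ⊗ T (j + 1ℤ)))
      ≈⟨ ⊕-cong ≈-refl
          (⊕-cong (⊗-cong ≈-refl (⊗-cong (sign (-1^-pred j)) ≈-refl))
              (⊗-cong ≈-refl (⊗-cong (sign (-1^-suc j)) ≈-refl))) ⟩
    (1ˢ ⊕ x ⊗ y) ⊗ f j ⊕ (x ⊗ (⊝ c₋ ⊗ T (j - 1ℤ)) ⊕ y ⊗ (⊝ c₊ ⊗ T (j + 1ℤ)))
      ≈⟨ ⊕-cong ≈-refl (⊕-cong (flip x c₋ (T (j - 1ℤ))) (flip y c₊ (T (j + 1ℤ)))) ⟩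
    (1ˢ ⊕ x ⊗ y) ⊗ f j ⊕ (⊝ x ⊗ f (j - 1ℤ) ⊕ ⊝ y ⊗ f (j + 1ℤ)) ∎
    where
    T : ℤ → Series
    T = tripleCoeff u v n n
    c c₋ c₊ : Series
    c  = const (-1^ j)
    c₋ = const (-1^ (j - 1ℤ))
    c₊ = const (-1^ (j + 1ℤ))
    flip : ∀ x c t → x ⊗ (⊝ c ⊗ t) ≈ ⊝ x ⊗ (c ⊗ t)
    flip = solve 3 (λ x c t → x :* (:- c :* t) := :- x :* (c :* t)) ≈-refl

progression-≥ : ∀ s w k → 0 < w → k ≤ progression s w k
progression-≥ s w zero    0<w = z≤n
progression-≥ s w (suc k) 0<w = subst (_≤ progression s w (suc k)) (ℕₚ.+-comm k 1)
  (ℕₚ.+-mono-≤ (progression-≥ s w k 0<w) (ℕₚ.≤-trans 0<w (ℕₚ.m≤m+n w (s ℕ.* k))))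

exponent-≥ : ∀ u v j → 0 < u → 0 < v → ∣ j ∣ ≤ exponent u v j
exponent-≥ u v (+ k)    0<u 0<v = progression-≥ (u ℕ.+ v) u k 0<u
exponent-≥ u v -[1+ k ] 0<u 0<v = progression-≥ (u ℕ.+ v) v (suc k) 0<v

-- The even exponents up to 6k are sorted by residue modulo 6; each induction step appends one
-- exponent to every class.
poch-trisect : ∀ k → poch 2 2 (k ℕ.* 3) ≈ poch 2 6 k ⊗ poch 4 6 k ⊗ poch 6 6 k
poch-trisect zero    = ≈-sym (≈-trans (⊗-identityʳ (1ˢ ⊗ 1ˢ)) (⊗-identityˡ 1ˢ))
poch-trisect (suc k) = begin
  F (2 ℕ.+ 2 ℕ.* (2 ℕ.+ k ℕ.* 3)) ⊗ (F
      (2 ℕ.+ 2 ℕ.* (1 ℕ.+ k ℕ.* 3)) ⊗ (F (2 ℕ.+ 2 ℕ.* (k ℕ.* 3)) ⊗ poch 2 2 (k ℕ.* 3)))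
    ≈⟨ ⊗-cong (≡⇒≈ (cong F (e₆ k)))
        (⊗-cong (≡⇒≈ (cong F (e₄ k))) (⊗-cong (≡⇒≈ (cong F (e₂ k))) (poch-trisect k))) ⟩
  F (6 ℕ.+ 6 ℕ.* k) ⊗ (F
      (4 ℕ.+ 6 ℕ.* k) ⊗ (F (2 ℕ.+ 6 ℕ.* k) ⊗ (poch 2 6 k ⊗ poch 4 6 k ⊗ poch 6 6 k)))
    ≈⟨ solve 6 (λ a b c x y z → c :* (b :* (a :* (x :* y :* z))) :=
        a :* x :* (b :* y) :* (c :* z)) ≈-refl
         (F (2 ℕ.+ 6 ℕ.* k)) (F (4 ℕ.+ 6 ℕ.* k)) (F (6 ℕ.+ 6 ℕ.* k)) (poch 2 6 k) (poch 4 6 k)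
             (poch 6 6 k) ⟩
  poch 2 6 (suc k) ⊗ poch 4 6 (suc k) ⊗ poch 6 6 (suc k) ∎
  where
  open SetoidReasoning setoid
  open Solver
  F : ℕ → Series
  F m = 1ˢ ⊖ q^ m
  e₂ : ∀ k → 2 ℕ.+ 2 ℕ.* (k ℕ.* 3) ≡ 2 ℕ.+ 6 ℕ.* k
  e₂ = ℕ-Solver.solve-∀
  e₄ : ∀ k → 2 ℕ.+ 2 ℕ.* (1 ℕ.+ k ℕ.* 3) ≡ 4 ℕ.+ 6 ℕ.* k
  e₄ = ℕ-Solver.solve-∀
  e₆ : ∀ k → 2 ℕ.+ 2 ℕ.* (2 ℕ.+ k ℕ.* 3) ≡ 6 ℕ.+ 6 ℕ.* k
  e₆ = ℕ-Solver.solve-∀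

poch∞-trisect : poch∞ 2 5 ⊗ poch∞ 4 5 ⊗ poch∞ 6 5 ≈ poch∞ 2 1
poch∞-trisect = ≈[]⇒≈ λ n → ≈[]-trans
  (≈[]-sym (⊗-cong[] (⊗-cong[] (poch≈[]poch∞ 2 5 {n} ℕₚ.≤-refl) (poch≈[]poch∞ 4 5 {n} ℕₚ.≤-refl))
      (poch≈[]poch∞ 6 5 {n} ℕₚ.≤-refl)))
  (≈[]-trans (≈⇒≈[] (≈-sym (poch-trisect n))) (poch≈[]poch∞ 2 1 (ℕₚ.m≤m*n n 3)))

-- Since exponent 2 4 j = 3 j² - j, this is the pentagonal number theorem in q².
euler-pentagonal : ∀ n B → n ℕ.+ n ≤ B →
  Σˢ (interval B) (λ j → const (-1^ j) ⊗ (q^ exponent 2 4 j)) ≈[ n ] poch∞ 2 1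
euler-pentagonal n B 2n≤B = begin
  Σ′                                     ≈⟨ ≈⇒≈[] (⊗-identityʳ Σ′) ⟨
  -- The factor `recip p` turns each monomial into the limit of a `tripleCoeff`, while p = (q⁶;q⁶)_∞
  -- supplies the exponents divisible by 6 that the product at z = -1 lacks.
  Σ′ ⊗ 1ˢ
      ≈⟨ ≈⇒≈[] (⊗-cong ≈-refl (recip-⊗ p (poch∞-at0 6 5 (s≤s z≤n)))) ⟨
  Σ′ ⊗ (recip p ⊗ p)                     ≈⟨ ≈⇒≈[] (⊗-assoc Σ′ (recip p) p) ⟨
  Σ′ ⊗ recip p ⊗ p                       ≈⟨ ⊗-cong[] (≈⇒≈[] (⊗-comm Σ′ (recip p))) ≈[]-refl ⟩
  recip p ⊗ Σ′ ⊗ p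
      ≈⟨ ⊗-cong[] (≈⇒≈[] (Σˢ-⊗ (interval B) (recip p) _)) ≈[]-refl ⟨
  Σˢ (interval B) (λ j → recip p ⊗ (const (-1^ j) ⊗ (q^ exponent 2 4 j))) ⊗ p
    ≈⟨ ⊗-cong[] (Σˢ-cong[] (interval B) (λ {j} _ → term j)) ≈[]-refl ⟩
  Σˢ (interval B) (λ j → const (-1^ j) ⊗ tripleCoeff 2 4 B B j) ⊗ p
    ≈⟨ ⊗-cong[] (≈⇒≈[] (alternating-tripleCoeff 2 4 B (s≤s z≤n) ℕₚ.≤-refl)) ≈[]-refl ⟩
  poch 2 6 B ⊗ poch 4 6 B ⊗ p
    ≈⟨ ⊗-cong[] (⊗-cong[] (poch≈[]poch∞ 2 5 n≤B) (poch≈[]poch∞ 4 5 n≤B)) ≈[]-refl ⟩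
  poch∞ 2 5 ⊗ poch∞ 4 5 ⊗ p              ≈⟨ ≈⇒≈[] poch∞-trisect ⟩
  poch∞ 2 1                              ∎
  where
  open SetoidReasoning setoid[ n ]
  open Solver
  n≤B : n ≤ B
  n≤B = ℕₚ.≤-trans (ℕₚ.m≤m+n n n) 2n≤B
  p Σ′ : Series
  p  = poch∞ 6 5
  Σ′ = Σˢ (interval B) (λ j → const (-1^ j) ⊗ (q^ exponent 2 4 j))
  limit : ∀ j → tripleCoeff 2 4 B B j ≈[ n ] (q^ exponent 2 4 j) ⊗ recip p
  limit j with ∣ j ∣ ℕₚ.≤? n
  -- For ∣ j ∣ ≤ n the bound 2n ≤ B leads into the range of the limit. For ∣ j ∣ > n both sides
  -- vanish modulo q^n, since the exponent is at least ∣ j ∣.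
  ... | yes j≤n = tripleCoeff-limit 2 4 5 refl n j j+n≤B j+n≤B
    where
    j+n≤B : n ℕ.+ ∣ j ∣ ≤ B
    j+n≤B = ℕₚ.≤-trans (ℕₚ.+-monoʳ-≤ n j≤n) 2n≤B
  ... | no j≰n = ≈[]-trans (vanish _) (≈[]-sym (vanish (recip p)))
    where
    vanish : ∀ f → (q^ exponent 2 4 j) ⊗ f ≈[ n ] const 0ℤ
    vanish f = ≈[]-trans
        (⊗-cong[] (q^≈[]0
            (ℕₚ.≤-trans (ℕₚ.<⇒≤ (ℕₚ.≰⇒> j≰n)) (exponent-≥ 2 4 j (s≤s z≤n) (s≤s z≤n)))) ≈[]-refl)
      (≈⇒≈[] (⊗-zeroˡ f))
  term : ∀ j → recip p ⊗ (const (-1^ j) ⊗ (q^ exponent 2 4 j)) ≈[ n ] const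
    (-1^ j) ⊗ tripleCoeff 2 4 B B j
  term j = ≈[]-trans
    (≈⇒≈[] (solve 3 (λ r c e → r :* (c :* e) := c :* (e :* r)) ≈-refl (recip p) (const (-1^ j))
        (q^ exponent 2 4 j)))
    (⊗-cong[] ≈[]-refl (≈[]-sym (limit j)))

-- The line sums

-- The choice u + v = 3, u - v = 1 makes 3n² + n twice an exponent. Besides exactness of the
-- division, this shows the pentagonal number to be natural, so that q can be raised to it within
-- power series.
pentagonal≡exponent : ∀ n → pentagonal n ≡ + exponent 2 1 n
pentagonal≡exponent n = begin
  (+ 3 * (n * n) + n) /ℕ 2
      ≡⟨ cong (λ x → (+ 3 * (n * n) + x) /ℕ 2) (sym (ℤₚ.*-identityˡ n)) ⟩
  (+ 3 * (n * n) + 1ℤ * n) /ℕ 2        ≡⟨ cong (_/ℕ 2) (2*exponent 2 1 n) ⟨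
  (+ 2 * + exponent 2 1 n) /ℕ 2
      ≡⟨ cong (_/ℕ 2) (trans (sym (ℤₚ.pos-* 2 (exponent 2 1 n)))
          (cong +_ (ℕₚ.*-comm 2 (exponent 2 1 n)))) ⟩
  + (exponent 2 1 n ℕ.* 2) /ℕ 2        ≡⟨ cong +_ (m*n/n≡m (exponent 2 1 n) 2) ⟩
  + exponent 2 1 n                     ∎
  where open ≡-Reasoning

-- Here α = n - 2γ. The cross term -2nγ of α(α+1)/2 cancels the 2nγ of (γ + n)², which is the reason
-- for centring β at n; the rest is (3n² + n)/2 + 3γ² - γ.
exponent-combine : ∀ n γ → exponent 1 0 (+ 3 * n - + 2 * (γ + n)) ℕ.+ exponent 1 1 (γ + n) ≡
  exponent 2 1 n ℕ.+ exponent 2 4 γ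
exponent-combine n γ = ℤₚ.+-injective (ℤₚ.*-cancelˡ-≡ (+ 2) _ _ (begin
  + 2 * (+ exponent 1 0 α + + exponent 1 1 β)
    ≡⟨ ℤₚ.*-distribˡ-+ (+ 2) (+ exponent 1 0 α) (+ exponent 1 1 β) ⟩
  + 2 * + exponent 1 0 α + + 2 * + exponent 1 1 β
    ≡⟨ cong₂ _+_ (2*exponent 1 0 α) (2*exponent 1 1 β) ⟩
  1ℤ * (α * α) + 1ℤ * α + (+ 2 * (β * β) + 0ℤ * β)
    ≡⟨ identity n γ ⟩
  + 3 * (n * n) + 1ℤ * n + (+ 6 * (γ * γ) + - + 2 * γ)
    ≡⟨ cong₂ _+_ (2*exponent 2 1 n) (2*exponent 2 4 γ) ⟨
  + 2 * + exponent 2 1 n + + 2 * + exponent 2 4 γ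
    ≡⟨ ℤₚ.*-distribˡ-+ (+ 2) (+ exponent 2 1 n) (+ exponent 2 4 γ) ⟨
  + 2 * (+ exponent 2 1 n + + exponent 2 4 γ) ∎))
  where
  open ≡-Reasoning
  α β : ℤ
  α = + 3 * n - + 2 * (γ + n)
  β = γ + n
  identity : ∀ n γ →
    1ℤ * ((+ 3 * n - + 2 * (γ + n)) * (+ 3 * n - + 2 * (γ + n))) + 1ℤ * (+ 3 * n - + 2 * (γ + n)) +
      (+ 2 * ((γ + n) * (γ + n)) + 0ℤ * (γ + n)) ≡
    + 3 * (n * n) + 1ℤ * n + (+ 6 * (γ * γ) + - + 2 * γ)
  identity = ℤ-Solver.solve-∀

-- The points of the line α + 2 β = m, indexed by γ = β - n.
linePoint : ℤ → ℤ → ℤ → ℤ × ℤ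
linePoint n m γ = m - + 2 * (γ + n) , γ + n

pairTerm⊗ : ℤ × ℤ → Series
pairTerm⊗ (α , β) = const (-1^ β) ⊗ (𝒜-sum α ⊗ 𝒞-sum β)

pairTerm≈ : ∀ p → pairTerm p ≈ pairTerm⊗ p
pairTerm≈ (α , β) =
    ≈-sym (≈-trans (⊗-cong ≈-refl (⊗≈*ˢ (𝒜-sum α) (𝒞-sum β)))
        (⊗≈*ˢ (const (-1^ β)) (𝒜-sum α *ˢ 𝒞-sum β)))

-- A point of the line is determined by β, and its term has order at least ∣ β ∣. Modulo q^(k+1)
-- only ∣ β ∣ ≤ k matters, and then ∣ γ ∣ = ∣ β - n ∣ is at most k + ∣ n ∣.
lineSum≈[] : ∀ n m k B → k ℕ.+ ∣ n ∣ ≤ B →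
  lineSum m ≈[ suc k ] Σˢ (interval B) (λ γ → pairTerm⊗ (linePoint n m γ))
lineSum≈[] n m k B k+n≤B .at< N (s≤s N≤k) = begin
  lineSum m N
    ≡⟨ ∑-at (Productₚ.≡-dec ℤₚ._≟_ ℤₚ._≟_) (pairTerm-locallyFinite m) N
         (Uniq.map⁺ injective (interval-unique B))
             (Allₚ.map⁺ (All.universal (onLine m n) (interval B))) out ⟩
  sumOver (map (linePoint n m) (interval B)) (λ p → pairTerm p N)
    ≡⟨ sumOver-map (linePoint n m) (interval B) (λ p → pairTerm p N) ⟩
  sumOver (interval B) (λ γ → pairTerm (linePoint n m γ) N)
    ≡⟨ sumOver-cong (interval B) (λ γ → pairTerm≈ (linePoint n m γ) .at N) ⟩
  sumOver (interval B) (λ γ → pairTerm⊗ (linePoint n m γ) N)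
    ≡⟨ Σˢ-at (interval B) (λ γ → pairTerm⊗ (linePoint n m γ)) N ⟨
  Σˢ (interval B) (λ γ → pairTerm⊗ (linePoint n m γ)) N ∎
  where
  open ≡-Reasoning
  injective : ∀ {γ δ} → linePoint n m γ ≡ linePoint n m δ → γ ≡ δ
  injective {γ} {δ} e = ∙-cancelʳ n γ δ (cong proj₂ e)
  onLine : ∀ m n γ → m - + 2 * (γ + n) + + 2 * (γ + n) ≡ m
  onLine = ℤ-Solver.solve-∀
  α≡ : ∀ α β n → α ≡ α + + 2 * β - + 2 * (β - n + n)
  α≡ = ℤ-Solver.solve-∀
  β≡ : ∀ β n → β ≡ β - n + n
  β≡ = ℤ-Solver.solve-∀
  out : ∀ {p} → OnLine m p → p ∉ map (linePoint n m) (interval B) → pairTerm p N ≡ 0ℤ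
  out {α , β} refl p∉ = outside {pairTerm (α , β)}
    (*ˢ-orderʳ (const (-1^ β)) (𝒜-sum α *ˢ 𝒞-sum β)
        (*ˢ-orderʳ (𝒜-sum α) (𝒞-sum β) (binomialSum-order 𝒞 𝒞-order β)))
    λ β≤N → ⊥-elim (p∉
        (subst (_∈ map (linePoint n m) (interval B)) (cong₂ _,_ (sym (α≡ α β n)) (sym (β≡ β n)))
      (∈-map⁺ (linePoint n m) (∈-interval (β - n)
        (ℕₚ.≤-trans (ℤₚ.∣i-j∣≤∣i∣+∣j∣ β n)
            (ℕₚ.≤-trans (ℕₚ.+-monoˡ-≤ ∣ n ∣ (ℕₚ.≤-trans β≤N N≤k)) k+n≤B))))))

Θ₆-recip : recip Θ₆ ≈ r ⊗ r ⊗ r ⊗ (ρ ⊗ ρ)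
Θ₆-recip = ⊗-inverse-unique (⊗-recip Θ₆ refl) (begin
  Θ₆ ⊗ (r ⊗ r ⊗ r ⊗ (ρ ⊗ ρ))
    ≈⟨ ⊗-cong (≈-trans (≈-sym (⊗≈*ˢ (p ^ˢ 3) (o ^ˢ 2)))
        (⊗-cong (≈-trans (≈-sym (⊗≈*ˢ p (p ^ˢ 2))) (⊗-cong ≈-refl (square≈ p)))
            (square≈ o))) ≈-refl ⟩
  p ⊗ (p ⊗ p) ⊗ (o ⊗ o) ⊗ (r ⊗ r ⊗ r ⊗ (ρ ⊗ ρ))
    ≈⟨ solve 4 (λ p o r ρ → p :* (p :* p) :* (o :* o) :* (r :* r :* r :* (ρ :* ρ)) :=
         p :* r :* (p :* r) :* (p :* r) :* (o :* ρ :* (o :* ρ))) ≈-refl p o r ρ ⟩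
  p ⊗ r ⊗ (p ⊗ r) ⊗ (p ⊗ r) ⊗ (o ⊗ ρ ⊗ (o ⊗ ρ))
    ≈⟨ ⊗-cong (⊗-cong (⊗-cong pr pr) pr) (⊗-cong oρ oρ) ⟩
  1ˢ ⊗ 1ˢ ⊗ 1ˢ ⊗ (1ˢ ⊗ 1ˢ)
    ≈⟨ solve 0 (con 1ℤ :* con 1ℤ :* con 1ℤ :* (con 1ℤ :* con 1ℤ) := con 1ℤ) ≈-refl ⟩
  1ˢ ∎)
  where
  open SetoidReasoning setoid
  open Solver
  p o : Series
  p = poch∞ 1 0
  o = poch∞ 1 1
  pr : p ⊗ r ≈ 1ˢ
  pr = ⊗-recip p (poch∞-at0 1 0 (s≤s z≤n))
  oρ : o ⊗ ρ ≈ 1ˢ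
  oρ = ⊗-recip o (poch∞-at0 1 1 (s≤s z≤n))

lineSums : ∀ n → lineSum (+ 3 * n + + 1) +ˢ lineSum (+ 3 * n) ≈
  const (-1^ n) ⊗ ((q^ exponent 2 1 n) ⊗ recip Θ₆)
lineSums n = ≈[]⇒≈ λ k →
  -- Large enough for both uses: the line sums need k + ∣ n ∣, the pentagonal series needs 2k.
  let B = k ℕ.+ k ℕ.+ ∣ n ∣
      open SetoidReasoning setoid[ k ]
      line : ∀ m → lineSum m ≈[ k ] Σˢ (interval B) (λ γ → pairTerm⊗ (linePoint n m γ))
      line m = ≈[]-weaken (ℕₚ.n≤1+n k) (lineSum≈[] n m k B (ℕₚ.+-monoˡ-≤ ∣ n ∣ (ℕₚ.m≤m+n k k)))
  in begin
  lineSum (+ 3 * n + + 1) +ˢ lineSum (+ 3 * n)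
    ≈⟨ ≈⇒≈[] (≡⇒≈ (cong (λ op → op (lineSum (+ 3 * n + + 1)) (lineSum (+ 3 * n))) (sym ⊕-def))) ⟩
  lineSum (+ 3 * n + + 1) ⊕ lineSum (+ 3 * n)
    ≈⟨ ⊕-cong[] (line (+ 3 * n + + 1)) (line (+ 3 * n)) ⟩
  Σˢ (interval B) (λ γ → pairTerm⊗ (linePoint n (+ 3 * n + + 1) γ)) ⊕
      Σˢ (interval B) (λ γ → pairTerm⊗ (linePoint n (+ 3 * n) γ))
    ≈⟨ ≈⇒≈[] (Σˢ-⊕ (interval B) _ _) ⟨
  Σˢ (interval B) (λ γ → pairTerm⊗ (linePoint n (+ 3 * n + + 1) γ) ⊕
      pairTerm⊗ (linePoint n (+ 3 * n) γ))
    ≈⟨ ≈⇒≈[] (Σˢ-cong (interval B) term) ⟩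
  Σˢ (interval B) (λ γ → K ⊗ (const (-1^ γ) ⊗ (q^ exponent 2 4 γ)))
    ≈⟨ ≈⇒≈[] (Σˢ-⊗ (interval B) K _) ⟩
  K ⊗ Σˢ (interval B) (λ γ → const (-1^ γ) ⊗ (q^ exponent 2 4 γ))
    ≈⟨ ⊗-cong[] ≈[]-refl (euler-pentagonal k B (ℕₚ.m≤m+n (k ℕ.+ k) ∣ n ∣)) ⟩
  K ⊗ poch∞ 2 1
    ≈⟨ ≈⇒≈[] (solve 6
        (λ c e r ρ σ p → c :* (e :* (r :* r :* r :* (ρ :* ρ) :* σ)) :* p :=
            c :* (e :* (r :* r :* r :* (ρ :* ρ) :* (σ :* p))))
         ≈-refl c e r ρ σ (poch∞ 2 1)) ⟩
  c ⊗ (e ⊗ (r ⊗ r ⊗ r ⊗ (ρ ⊗ ρ) ⊗ (σ ⊗ poch∞ 2 1)))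
    ≈⟨ ≈⇒≈[] (⊗-cong ≈-refl
        (⊗-cong ≈-refl (≈-trans (⊗-cong ≈-refl (recip-⊗ (poch∞ 2 1) (poch∞-at0 2 1 (s≤s z≤n))))
         (≈-trans (⊗-identityʳ _) (≈-sym Θ₆-recip))))) ⟩
  c ⊗ (e ⊗ recip Θ₆) ∎
  where
  open Solver
  c e K : Series
  c = const (-1^ n)
  e = q^ exponent 2 1 n
  K = c ⊗ (e ⊗ (r ⊗ r ⊗ r ⊗ (ρ ⊗ ρ) ⊗ σ))
  next : ∀ n γ → + 3 * n + + 1 - + 2 * (γ + n) ≡ + 3 * n - + 2 * (γ + n) + 1ℤ
  next = ℤ-Solver.solve-∀
  term : ∀ γ → pairTerm⊗ (linePoint n (+ 3 * n + + 1) γ) ⊕ pairTerm⊗ (linePoint n (+ 3 * n) γ) ≈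
    K ⊗ (const (-1^ γ) ⊗ (q^ exponent 2 4 γ))
  term γ = begin
    s ⊗ (𝒜-sum (+ 3 * n + + 1 - + 2 * β) ⊗ 𝒞-sum β) ⊕ s ⊗ (𝒜-sum α ⊗ 𝒞-sum β)
      ≈⟨ ⊕-cong (⊗-cong ≈-refl (⊗-cong (≡⇒≈ (cong 𝒜-sum (next n γ))) ≈-refl)) ≈-refl ⟩
    s ⊗ (𝒜-sum (α + 1ℤ) ⊗ 𝒞-sum β) ⊕ s ⊗ (𝒜-sum α ⊗ 𝒞-sum β)
      ≈⟨ solve 4 (λ s a b d → s :* (b :* d) :+ s :* (a :* d) := s :* ((a :+ b) :* d)) ≈-refl s
          (𝒜-sum α) (𝒜-sum (α + 1ℤ)) (𝒞-sum β) ⟩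
    s ⊗ ((𝒜-sum α ⊕ 𝒜-sum (α + 1ℤ)) ⊗ 𝒞-sum β)
      ≈⟨ ⊗-cong (≈-trans (≡⇒≈ (cong const (-1^-+ γ n))) (const-⊗ (-1^ γ) (-1^ n)))
          (⊗-cong (𝒜-sum-pair α) (𝒞-sum-closed β)) ⟩
    g ⊗ c ⊗ (r ⊗ r ⊗ (x ⊗ r) ⊗ (ρ ⊗ ρ ⊗ (y ⊗ σ)))
      ≈⟨ solve 7 (λ g c r x ρ y σ → g :* c :* (r :* r :* (x :* r) :* (ρ :* ρ :* (y :* σ))) :=
           c :* (r :* r :* r :* (ρ :* ρ) :* σ) :* (g :* (x :* y))) ≈-refl g c r x ρ y σ ⟩
    c ⊗ (r ⊗ r ⊗ r ⊗ (ρ ⊗ ρ) ⊗ σ) ⊗ (g ⊗ (x ⊗ y))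
      ≈⟨ ⊗-cong ≈-refl (⊗-cong ≈-refl (≈-trans (≈-sym (q^-+ (exponent 1 0 α) (exponent 1 1 β)))
           (≈-trans (≡⇒≈ (cong q^_ (exponent-combine n γ)))
               (q^-+ (exponent 2 1 n) (exponent 2 4 γ))))) ⟩
    c ⊗ (r ⊗ r ⊗ r ⊗ (ρ ⊗ ρ) ⊗ σ) ⊗ (g ⊗ (e ⊗ z))
      ≈⟨ solve 5 (λ c k g e z → c :* k :* (g :* (e :* z)) := c :* (e :* k) :* (g :* z)) ≈-refl c
          (r ⊗ r ⊗ r ⊗ (ρ ⊗ ρ) ⊗ σ) g e z ⟩
    K ⊗ (g ⊗ z) ∎
    where
    open SetoidReasoning setoid
    α β : ℤ
    α = + 3 * n - + 2 * (γ + n)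
    β = γ + n
    s g x y z : Series
    s = const (-1^ β)
    g = const (-1^ γ)
    x = q^ exponent 1 0 α
    y = q^ exponent 1 1 β
    z = q^ exponent 2 4 γ

-- Shifts of Laurent series

coeff-shift-≥ : ∀ m f j {N} → j - m ≡ + N → coeff (m ∙ f) j ≡ f N
coeff-shift-≥ m f j e with j - m | e
... | _ | refl = refl

coeff-shift-< : ∀ m f j {N} → j - m ≡ -[1+ N ] → coeff (m ∙ f) j ≡ 0ℤ
coeff-shift-< m f j e with j - m | e
... | _ | refl = refl

-- The two representations have different shifts, so they are compared coefficientwise. At negative
-- j the left side is 0; the right side is either a coefficient of g of index below p, which
-- vanishes, or lies below the shift.
ι≈ᴸshift : ∀ p f {g} → g ≈ (q^ p) ⊗ f → ι f ≈ᴸ (- + p ∙ g)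
ι≈ᴸshift p f {g} e (+ N) = sym (trans
  (coeff-shift-≥ (- + p) g (+ N) {p ℕ.+ N}
      (trans (+-congˡ (+ N) (ℤₚ.neg-involutive (+ p))) (cong +_ (ℕₚ.+-comm N p))))
  (trans (e .at (p ℕ.+ N)) (trans (q^-⊗-shift p f N) (cong f (sym (ℕₚ.+-identityʳ N))))))
ι≈ᴸshift p f {g} e -[1+ k ] = sym (go (suc k ℕₚ.≤? p))
  where
  shifted : -[1+ k ] - (- + p) ≡ p ℤ.⊖ suc k
  shifted = +-congˡ -[1+ k ] (ℤₚ.neg-involutive (+ p))
  go : _ → coeff (- + p ∙ g) -[1+ k ] ≡ 0ℤ
  go (yes k<p) = trans (coeff-shift-≥ (- + p) g -[1+ k ] (trans shifted (ℤₚ.⊖-≥ k<p)))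
    (trans (e .at (p ∸ suc k)) (q^-⊗-order p f (ℕₚ.∸-monoʳ-< (s≤s z≤n) k<p)))
  go (no k≮p) with suc k ∸ p in eq | ℕₚ.m<n⇒0<n∸m (ℕₚ.≰⇒> k≮p)
  ... | suc i | _ = coeff-shift-< (- + p) g -[1+ k ]
    (trans shifted (trans (ℤₚ.⊖-< (ℕₚ.≰⇒> k≮p)) (cong (λ x → - + x) eq)))

theorem1p1 : (n : ℤ) →
    ι (recip Θ₆) ≈ᴸ
    ι (const (-1^ n)) *ᴸ qᴸ^ (- pentagonal n) *ᴸ
    ι (lineSum (+ 3 * n + + 1) +ˢ lineSum (+ 3 * n))
theorem1p1 n j = trans
  (ι≈ᴸshift (exponent 2 1 n) (recip Θ₆) body j)
  (cong (λ m → coeff (m ∙ g) j) (sym shift))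
  where
  L g : Series
  L = lineSum (+ 3 * n + + 1) +ˢ lineSum (+ 3 * n)
  g = const (-1^ n) *ˢ 1ˢ *ˢ L
  shift : 0ℤ + - pentagonal n + 0ℤ ≡ - + exponent 2 1 n
  shift = trans (ℤₚ.+-identityʳ _) (trans (ℤₚ.+-identityˡ _) (cong -_ (pentagonal≡exponent n)))
  body : g ≈ (q^ exponent 2 1 n) ⊗ recip Θ₆
  body = begin
    const (-1^ n) *ˢ 1ˢ *ˢ L
      ≈⟨ ⊗≈*ˢ (const (-1^ n) *ˢ 1ˢ) L ⟨
    const (-1^ n) *ˢ 1ˢ ⊗ L
      ≈⟨ ⊗-cong (≈-trans (≈-sym (⊗≈*ˢ (const (-1^ n)) 1ˢ)) (⊗-identityʳ _)) (lineSums n) ⟩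
    const (-1^ n) ⊗ (const (-1^ n) ⊗ ((q^ exponent 2 1 n) ⊗ recip Θ₆))
      ≈⟨ ⊗-assoc _ _ _ ⟨
    const (-1^ n) ⊗ const (-1^ n) ⊗ ((q^ exponent 2 1 n) ⊗ recip Θ₆)
      ≈⟨ ⊗-cong (≈-trans (≈-sym (const-⊗ (-1^ n) (-1^ n)))
          (≡⇒≈ (cong const (-1^-square n)))) ≈-refl ⟩
    1ˢ ⊗ ((q^ exponent 2 1 n) ⊗ recip Θ₆)
      ≈⟨ ⊗-identityˡ _ ⟩
    (q^ exponent 2 1 n) ⊗ recip Θ₆ ∎
    where open SetoidReasoning setoid
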